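{- Let $q$ be a prime power. Then: (i) $\ell_q(u,n)=u+q$ for all integers $n\ge1$ and $1\le u\le\min\{n,q\}$; (ii) $\ell_q(sq)=sq+q$ for $1\le s\le q$; (iii) $\ell_q(q+1,n)=2(q+1)$ for all $n\ge2$; (iv) if $q$ is even, $\ell_q(q+2,n)=2(q+1)$ for all $n\ge 2$; (v) $\ell_q(q^2-2q+1)=q^2-1$; (vi) $\ell_q(u)=q^2$ for $q^2-2q+2\le u\le q^2-q$; (vii) $\ell_q(u)=q^2+q$ for $q^2-q+1\le u\le q^2$.
   Context: In the affine plane $\mathrm{AG}(2,q)$, a transversal is a set $\mathcal{T}=\{L_1,\dots,L_{q+1}\}$ of $q+1$ pairwise non-parallel lines (one from each parallel class). For a set $\mathcal{F}$ of points of $\mathrm{AG}(2,q)$ put $\mathcal{F}(\mathcal{T})=\sum_{i=1}^{q+1}|\mathcal{F}\cap L_i|$. A projective $(u,n)$-arc in $\mathrm{AG}(2,q)$ is a set of $u$ points meeting every line in at most $n$ points. For integers $u,n\ge0$ such that a projective $(u,n)$-arc in $\mathrm{AG}(2,q)$ exists, $\ell_q(u,n)$ is the minimum, over all projective $(u,n)$-arcs $\mathcal{F}$ in $\mathrm{AG}(2,q)$, of $\max\{\mathcal{F}(\mathcal{T}):\mathcal{T}\text{ a transversal of }\mathrm{AG}(2,q)\}$. For $0\le u\le q^2$, $\ell_q(u)=\ell_q(u,q)$ (the same minimum over all sets of $u$ points). In parts (i),(iii),(iv) the value $u$ is assumed to be such that a projective $(u,n)$-arc in $\mathrm{AG}(2,q)$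 exists. -}

module Defs where

open import Algebra.Structures using (IsCommutativeRing)
open import Algebra.Properties.CommutativeMonoid.Sum using (sum)
open import Data.Fin.Base using (Fin)
open import Data.Fin.Properties using (inj⇒≟)
open import Data.List.Base using (List; length; filter)
open import Data.List.Relation.Unary.Unique.Propositional using (Unique)
open import Data.Nat.Base using (ℕ; suc; _≤_; _^_)
open import Data.Nat.Primality using (Prime)
open import Data.Nat.Properties using (+-0-commutativeMonoid)
open import Data.Product.Base using (_×_; _,_; ∃-syntax)
open import Data.Sum.Base using (_⊎_)
open import Function.Bundles using (_↔_)
open import Function.Properties.Inverse using (↔-sym; ↔⇒↣)
open import Relation.Binary.Definitions using (DecidableEquality)
open import Relation.Binary.PropositionalEquality using (_≡_; _≢_)
open import Relation.Nullary using (¬_)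
open import Relation.Unary using (Pred; Decidable; _≐_; _⊥_)
open import Level using (0ℓ)

IsPrimePower : ℕ → Set
IsPrimePower q = ∃[ p ] ∃[ k ] Prime p × 1 ≤ k × q ≡ p ^ k

IsMaximum : Pred ℕ 0ℓ → Pred ℕ 0ℓ
IsMaximum P m = P m × (∀ k → P k → k ≤ m)

IsMinimum : Pred ℕ 0ℓ → Pred ℕ 0ℓ
IsMinimum P m = P m × (∀ k → P k → m ≤ k)

record FiniteField (q : ℕ) : Set₁ where
  infix  8 -_
  infixl 7 _*_
  infixl 6 _+_
  field
    Carrier           : Set
    _+_ _*_           : Carrier → Carrier → Carrier
    -_                : Carrier → Carrier
    0# 1#             : Carrier
    isCommutativeRing : IsCommutativeRing _≡_ _+_ _*_ -_ 0# 1#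
    0≢1               : 0# ≢ 1#
    inverse           : ∀ x → x ≢ 0# → ∃[ y ] x * y ≡ 1#
    enumeration       : Fin q ↔ Carrier

  _≟_ : DecidableEquality Carrier
  _≟_ = inj⇒≟ (↔⇒↣ (↔-sym enumeration))

module AG {q : ℕ} (K : FiniteField q) where
  open FiniteField K

  Point : Set
  Point = Carrier × Carrier

  -- The line with equation a x + b y = c.  Proportional equations give the same
  -- line, so lines are compared through their point sets, never through _≡_.
  record Line : Set where
    field
      a b c         : Carrier
      nondegenerate : ¬ (a ≡ 0# × b ≡ 0#)

  On : Line → Pred Point 0ℓ
  On L (x , y) = a * x + b * y ≡ c
    where open Line L

  On? : (L : Line) → Decidable (On L)
  On? L (x , y) = (a * x + b * y) ≟ c
    where open Line L

  infix 4 _∥_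
  _∥_ : Line → Line → Set
  L ∥ M = (On L ≐ On M) ⊎ (On L ⊥ On M)

  record PointSet : Set where
    field
      points : List Point
      unique : Unique points
  open PointSet public

  ∣_∣ : PointSet → ℕ
  ∣ F ∣ = length (points F)

  ∣_∩_∣ : PointSet → Line → ℕ
  ∣ F ∩ L ∣ = length (filter (On? L) (points F))

  record Transversal : Set where
    field
      line        : Fin (suc q) → Line
      nonparallel : ∀ i j → i ≢ j → ¬ (line i ∥ line j)
  open Transversal public

  -- The number F(T).
  weight : PointSet → Transversal → ℕ
  weight F T = sum +-0-commutativeMonoid (λ i → ∣ F ∩ line T i ∣)

  IsArc : ℕ → ℕ → PointSet → Set
  IsArc u n F = ∣ F ∣ ≡ u × (∀ L → ∣ F ∩ L ∣ ≤ n)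

  ArcExists : ℕ → ℕ → Set
  ArcExists u n = ∃[ F ] IsArc u n F

  IsMaxWeight : PointSet → ℕ → Set
  IsMaxWeight F = IsMaximum (λ k → ∃[ T ] weight F T ≡ k)

  -- The equation ℓ_q(u,n) = m, including that ℓ_q(u,n) is defined.
  infix 4 ℓ⟨_∶_⟩≡_ ℓ⟨_⟩≡_
  ℓ⟨_∶_⟩≡_ : ℕ → ℕ → ℕ → Set
  ℓ⟨ u ∶ n ⟩≡ m = IsMinimum (λ k → ∃[ F ] IsArc u n F × IsMaxWeight F k) m

  ℓ⟨_⟩≡_ : ℕ → ℕ → Set
  ℓ⟨ u ⟩≡ m = ℓ⟨ u ∶ q ⟩≡ m

{-# OPTIONS --safe #-}
module Submission where

-- A transversal has one line in every parallel class, so the maximum of F(T) is attained by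
-- choosing a heaviest line in each class.  Two lower bounds are elementary: the pencil of a
-- point of F has weight |F| + q, and if |F| > qm then every class has a line with more than m
-- points of F.  They are attained by initial segments of grids A × B ⊆ K², and by the conic
-- N(x,y) = 1 of an anisotropic quadratic form N (with its nucleus (0,0) added if q is even),
-- which meets every line in at most two points.
-- In (vi) one class must have a line contained in F.  This is the theorem of Jamison and of
-- Brouwer and Schrijver that a set B meeting all lines of AG(2,q) has at least 2q − 1 points:
-- if (0,0) ∈ B, the product of the factors 1 − ax − by over the other points (x,y) of B is 1 at
-- (a,b) = (0,0) and 0 elsewhere, so it sums to 1 over K², whereas a polynomial of degree below
-- 2(q − 1) sums to 0.

open import Defs
open import Algebra.Bundles using (CommutativeRing; RawRing)
import Algebra.Properties.AbelianGroup as AbelianGroupProperties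
import Algebra.Properties.CommutativeMonoid.Sum as MonoidSum
import Algebra.Properties.CommutativeSemigroup as CommutativeSemigroupProperties
import Algebra.Properties.CommutativeSemiring.Exp as CommutativeSemiringExp
import Algebra.Properties.Group as GroupProperties
import Algebra.Properties.Ring as RingProperties
import Algebra.Properties.Semiring.Exp as SemiringExp
import Algebra.Properties.Semiring.Mult as SemiringMult
import Algebra.Properties.Semiring.Mult.TCOptimised as OptimisedMult
import Algebra.Properties.Semiring.Sum as SemiringSum
import Algebra.Solver.Ring as RingSolver
open import Algebra.Solver.Ring.AlmostCommutativeRing using (_-Raw-AlmostCommutative⟶_; fromCommutativeRing)
open import Data.Bool.Base using (true; false)
open import Data.Fin.Base using (Fin; zero; suc; punchIn)
import Data.Fin.Properties as Fin
open import Data.List.Base using (List; []; _∷_; _++_; map; filter; length; take; tabulate; cartesianProduct)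
import Data.List.Membership.DecPropositional as DecMembership
open import Data.List.Membership.Propositional using (_∈_; lose; find)
open import Data.List.Membership.Propositional.Properties
  using (∈-∃++; ∈-++⁻; ∈-++⁺ˡ; ∈-++⁺ʳ; ∈-map⁺; ∈-map⁻; ∈-filter⁺; ∈-filter⁻; ∈-tabulate⁺; ∈-tabulate⁻; ∈-cartesianProduct⁺; ∈-cartesianProduct⁻)
import Data.List.Properties as List
open import Data.List.Relation.Binary.Subset.Propositional using (_⊆_)
open import Data.List.Relation.Unary.All as All using (All; []; _∷_)
import Data.List.Relation.Unary.All.Properties as All
open import Data.List.Relation.Unary.AllPairs using ([]; _∷_)
open import Data.List.Relation.Unary.Any as Any using (Any; here; there)
open import Data.List.Relation.Unary.Unique.Propositional using (Unique)
import Data.List.Relation.Unary.Unique.Propositional.Properties as Unique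
open import Data.Maybe.Base using (Maybe; just; nothing)
open import Data.Nat.Base as ℕ using (ℕ; zero; suc; _≤_; _<_; z≤n; s≤s)
open import Data.Nat.Divisibility using (_∣_; ∣1⇒≡1)
open import Data.Nat.Primality using (Prime; euclidsLemma; prime[2]; prime⇒irreducible)
import Data.Nat.Properties as ℕ
import Data.Nat.Solver as NatSolver
open import Data.Product.Base using (_×_; _,_; ∃-syntax; proj₁; proj₂)
open import Data.Product.Properties using (≡-dec)
open import Data.Sum.Base using (_⊎_; inj₁; inj₂)
open import Function.Base using (_∘_)
open import Function.Bundles using (_↔_; mk↔ₛ′; Inverse)
open import Function.Properties.Inverse using (↔-sym; ↔-trans)
open import Level using (0ℓ)
open import Relation.Binary.PropositionalEquality as ≡ using (_≡_; _≢_)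
import Relation.Binary.Reasoning.Setoid as SetoidReasoning
open import Relation.Nullary using (¬_; yes; no; Dec; does; contradiction)
open import Relation.Nullary.Decidable using (¬?; dec-true; decidable-stable)
open import Relation.Unary using (Pred; Decidable)

-- A ring solver with integer coefficients for commutative rings.

module IntegerCoefficients {c ℓ} (R : CommutativeRing c ℓ) where
  open CommutativeRing R
  open OptimisedMult semiring using (×-homo-+; ×1-homo-*) renaming (_×_ to _·_)
  open RingProperties ring using (-‿distribˡ-*; -‿distribʳ-*; -0#≈0#)
  open AbelianGroupProperties +-abelianGroup using (⁻¹-∙-comm; ⁻¹-involutive)
  open CommutativeSemigroupProperties +-commutativeSemigroup using (interchange)
  open SetoidReasoning setoid

  reduce : ℕ × ℕ → ℕ × ℕ
  reduce (a , b) = a ℕ.∸ b , b ℕ.∸ a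

  -- The pair (m , n) stands for the integer m − n; the solver compares coefficients
  -- syntactically, so the operations return reduced pairs.
  differences : RawRing _ _
  differences = record
    { Carrier = ℕ × ℕ
    ; _≈_     = _≡_
    ; _+_     = λ (a , b) (c , d) → reduce (a ℕ.+ c , b ℕ.+ d)
    ; _*_     = λ (a , b) (c , d) → reduce (a ℕ.* c ℕ.+ b ℕ.* d , a ℕ.* d ℕ.+ b ℕ.* c)
    ; -_      = λ (a , b) → b , a
    ; 0#      = 0 , 0
    ; 1#      = 1 , 0
    }

  -- The first clause makes the coefficients 0 and 1 evaluate to 0# and 1# on the nose.
  ⟦_⟧ : ℕ × ℕ → Carrier
  ⟦ a , zero  ⟧ = a · 1#
  ⟦ a , suc b ⟧ = a · 1# - suc b · 1#

  ⟦⟧≈ : ∀ a b → ⟦ a , b ⟧ ≈ a · 1# - b · 1#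
  ⟦⟧≈ a zero    = sym (trans (+-congˡ -0#≈0#) (+-identityʳ _))
  ⟦⟧≈ a (suc b) = refl

  +-homo-⟦⟧ : ∀ a b c d → ⟦ a ℕ.+ c , b ℕ.+ d ⟧ ≈ ⟦ a , b ⟧ + ⟦ c , d ⟧
  +-homo-⟦⟧ a b c d = begin
    ⟦ a ℕ.+ c , b ℕ.+ d ⟧                          ≈⟨ ⟦⟧≈ (a ℕ.+ c) (b ℕ.+ d) ⟩
    (a ℕ.+ c) · 1# - (b ℕ.+ d) · 1#                ≈⟨ +-cong (×-homo-+ 1# a c) (-‿cong (×-homo-+ 1# b d)) ⟩
    (a · 1# + c · 1#) - (b · 1# + d · 1#)          ≈⟨ +-congˡ (⁻¹-∙-comm _ _) ⟨
    (a · 1# + c · 1#) + (- (b · 1#) + - (d · 1#))  ≈⟨ interchange _ _ _ _ ⟩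
    (a · 1# - b · 1#) + (c · 1# - d · 1#)          ≈⟨ +-cong (⟦⟧≈ a b) (⟦⟧≈ c d) ⟨
    ⟦ a , b ⟧ + ⟦ c , d ⟧                          ∎

  [x-y][z-w] : ∀ x y z w → (x - y) * (z - w) ≈ (x * z + y * w) - (x * w + y * z)
  [x-y][z-w] x y z w = begin
    (x - y) * (z - w)                                    ≈⟨ distribʳ _ _ _ ⟩
    x * (z - w) + - y * (z - w)                          ≈⟨ +-cong (distribˡ _ _ _) (trans (distribˡ _ _ _) (+-comm _ _)) ⟩
    (x * z + x * - w) + (- y * - w + - y * z)            ≈⟨ +-cong (+-congˡ (-‿distribʳ-* x w)) (+-cong -y*-w≈y*w (-‿distribˡ-* y z)) ⟨
    (x * z + - (x * w)) + (y * w + - (y * z))            ≈⟨ interchange _ _ _ _ ⟩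
    (x * z + y * w) + (- (x * w) + - (y * z))            ≈⟨ +-congˡ (⁻¹-∙-comm _ _) ⟩
    (x * z + y * w) - (x * w + y * z)                    ∎
    where
    -y*-w≈y*w : y * w ≈ - y * - w
    -y*-w≈y*w = begin
      y * w         ≈⟨ ⁻¹-involutive _ ⟨
      - - (y * w)   ≈⟨ -‿cong (-‿distribʳ-* y w) ⟩
      - (y * - w)   ≈⟨ -‿distribˡ-* y (- w) ⟩
      - y * - w     ∎

  *-homo-⟦⟧ : ∀ a b c d → ⟦ a ℕ.* c ℕ.+ b ℕ.* d , a ℕ.* d ℕ.+ b ℕ.* c ⟧ ≈ ⟦ a , b ⟧ * ⟦ c , d ⟧
  *-homo-⟦⟧ a b c d = begin
    ⟦ a ℕ.* c ℕ.+ b ℕ.* d , a ℕ.* d ℕ.+ b ℕ.* c ⟧    ≈⟨ ⟦⟧≈ (a ℕ.* c ℕ.+ b ℕ.* d) (a ℕ.* d ℕ.+ b ℕ.* c) ⟩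
    (a ℕ.* c ℕ.+ b ℕ.* d) · 1# - (a ℕ.* d ℕ.+ b ℕ.* c) · 1#  ≈⟨ +-cong (expand a c b d) (-‿cong (expand a d b c)) ⟩
    (a′ * c′ + b′ * d′) - (a′ * d′ + b′ * c′)         ≈⟨ [x-y][z-w] a′ b′ c′ d′ ⟨
    (a′ - b′) * (c′ - d′)                             ≈⟨ *-cong (⟦⟧≈ a b) (⟦⟧≈ c d) ⟨
    ⟦ a , b ⟧ * ⟦ c , d ⟧                             ∎
    where
    a′ = a · 1#
    b′ = b · 1#
    c′ = c · 1#
    d′ = d · 1#
    expand : ∀ m n k l → (m ℕ.* n ℕ.+ k ℕ.* l) · 1# ≈ m · 1# * (n · 1#) + k · 1# * (l · 1#)
    expand m n k l = trans (×-homo-+ 1# (m ℕ.* n) (k ℕ.* l)) (+-cong (×1-homo-* m n) (×1-homo-* k l))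

  -‿homo-⟦⟧ : ∀ a b → ⟦ b , a ⟧ ≈ - ⟦ a , b ⟧
  -‿homo-⟦⟧ a b = begin
    ⟦ b , a ⟧                    ≈⟨ ⟦⟧≈ b a ⟩
    b · 1# - a · 1#              ≈⟨ +-comm _ _ ⟩
    - (a · 1#) + b · 1#          ≈⟨ +-congˡ (⁻¹-involutive _) ⟨
    - (a · 1#) + - - (b · 1#)    ≈⟨ ⁻¹-∙-comm _ _ ⟩
    - (a · 1# - b · 1#)          ≈⟨ -‿cong (⟦⟧≈ a b) ⟨
    - ⟦ a , b ⟧                  ∎

  -- Adding d - d on one side and b - b on the other turns both into the value of the same pair.
  ⟦⟧-cong : ∀ a b c d → a ℕ.+ d ≡ c ℕ.+ b → ⟦ a , b ⟧ ≈ ⟦ c , d ⟧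
  ⟦⟧-cong a b c d eq = begin
    ⟦ a , b ⟧                      ≈⟨ +-identityʳ _ ⟨
    ⟦ a , b ⟧ + 0#                 ≈⟨ +-congˡ (trans (⟦⟧≈ d d) (-‿inverseʳ _)) ⟨
    ⟦ a , b ⟧ + ⟦ d , d ⟧          ≈⟨ +-homo-⟦⟧ a b d d ⟨
    ⟦ a ℕ.+ d , b ℕ.+ d ⟧          ≡⟨ ≡.cong₂ (λ m n → ⟦ m , n ⟧) eq (ℕ.+-comm b d) ⟩
    ⟦ c ℕ.+ b , d ℕ.+ b ⟧          ≈⟨ +-homo-⟦⟧ c d b b ⟩
    ⟦ c , d ⟧ + ⟦ b , b ⟧          ≈⟨ +-congˡ (trans (⟦⟧≈ b b) (-‿inverseʳ _)) ⟩
    ⟦ c , d ⟧ + 0#                 ≈⟨ +-identityʳ _ ⟩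
    ⟦ c , d ⟧                      ∎

  ⟦⟧-reduce : ∀ a b → ⟦ reduce (a , b) ⟧ ≈ ⟦ a , b ⟧
  ⟦⟧-reduce a b = ⟦⟧-cong (a ℕ.∸ b) (b ℕ.∸ a) a b (balance a b)
    where
    balance : ∀ a b → a ℕ.∸ b ℕ.+ b ≡ a ℕ.+ (b ℕ.∸ a)
    balance zero    b       = ≡.cong (ℕ._+ b) (ℕ.0∸n≡0 b)
    balance (suc a) zero    = ≡.refl
    balance (suc a) (suc b) = ≡.trans (ℕ.+-suc (a ℕ.∸ b) b) (≡.cong suc (balance a b))

  homomorphism : differences -Raw-AlmostCommutative⟶ fromCommutativeRing R
  homomorphism = record
    { ⟦_⟧    = ⟦_⟧
    ; +-homo = λ (a , b) (c , d) → trans (⟦⟧-reduce (a ℕ.+ c) (b ℕ.+ d)) (+-homo-⟦⟧ a b c d)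
    ; *-homo = λ (a , b) (c , d) → trans (⟦⟧-reduce (a ℕ.* c ℕ.+ b ℕ.* d) (a ℕ.* d ℕ.+ b ℕ.* c)) (*-homo-⟦⟧ a b c d)
    ; -‿homo = λ (a , b) → -‿homo-⟦⟧ a b
    ; 0-homo = refl
    ; 1-homo = refl
    }

  equal? : ∀ x y → Maybe (⟦ x ⟧ ≈ ⟦ y ⟧)
  equal? (a , b) (c , d) with a ℕ.+ d ℕ.≟ c ℕ.+ b
  ... | yes eq = just (⟦⟧-cong a b c d eq)
  ... | no  _  = nothing

  open RingSolver differences (fromCommutativeRing R) homomorphism equal? public
    using (solve; _:=_; _:+_; _:*_; _:-_; :-_; con)

open ≡ using (refl; sym; trans; cong; cong₂; subst; module ≡-Reasoning)

-- Counting with duplicate-free lists.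

module _ {A : Set} where

  -- Deleting one occurrence of the head `x` from `ys` leaves a list that still contains the tail,
  -- because `x` does not recur in the tail.
  unique-⊆⇒length≤ : ∀ {xs ys : List A} → Unique xs → xs ⊆ ys → length xs ≤ length ys
  unique-⊆⇒length≤ {[]} _ _ = z≤n
  unique-⊆⇒length≤ {x ∷ xs} {ys} (x∉xs ∷ xs!) xs⊆ys with ∈-∃++ (xs⊆ys (here refl))
  ... | as , bs , refl = begin
    suc (length xs)              ≤⟨ s≤s (unique-⊆⇒length≤ xs! xs⊆as++bs) ⟩
    suc (length (as ++ bs))      ≡⟨ cong suc (List.length-++ as) ⟩
    suc (length as ℕ.+ length bs)  ≡⟨ ℕ.+-suc (length as) (length bs) ⟨
    length as ℕ.+ suc (length bs)  ≡⟨ List.length-++ as ⟨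
    length (as ++ x ∷ bs)        ∎
    where
    open ℕ.≤-Reasoning
    xs⊆as++bs : xs ⊆ as ++ bs
    xs⊆as++bs y∈xs with ∈-++⁻ as (xs⊆ys (there y∈xs))
    ... | inj₁ y∈as         = ∈-++⁺ˡ y∈as
    ... | inj₂ (here refl)  = contradiction refl (All.lookup x∉xs y∈xs)
    ... | inj₂ (there y∈bs) = ∈-++⁺ʳ as y∈bs

  -- The hypothesis has the shape in which `secant` delivers it: two elements that differ from a
  -- common third one coincide.
  at-most-two : ∀ {xs : List A} → Unique xs →
    (∀ {x y z} → x ∈ xs → y ∈ xs → z ∈ xs → x ≢ y → x ≢ z → y ≡ z) → length xs ≤ 2
  at-most-two {[]}             _ _ = z≤n
  at-most-two {_ ∷ []}         _ _ = s≤s z≤n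
  at-most-two {_ ∷ _ ∷ []}     _ _ = ℕ.≤-refl
  at-most-two {_ ∷ _ ∷ _ ∷ _} ((x≢y ∷ x≢z ∷ _) ∷ (y≢z ∷ _) ∷ _) third =
    contradiction (third (here refl) (there (here refl)) (there (there (here refl))) x≢y x≢z) y≢z

  at-most-one : ∀ {xs : List A} → Unique xs → (∀ {x y} → x ∈ xs → y ∈ xs → x ≡ y) → length xs ≤ 1
  at-most-one {[]}        _ _ = z≤n
  at-most-one {_ ∷ []}    _ _ = ℕ.≤-refl
  at-most-one {_ ∷ _ ∷ _} ((x≢y ∷ _) ∷ _) second =
    contradiction (second (here refl) (there (here refl))) x≢y

  take-⊆ : ∀ n (xs : List A) → take n xs ⊆ xs
  take-⊆ (suc n) (x ∷ xs) (here eq)  = here eq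
  take-⊆ (suc n) (x ∷ xs) (there y∈) = there (take-⊆ n xs y∈)

  length-take-≤ : ∀ {n} {xs : List A} → n ≤ length xs → length (take n xs) ≡ n
  length-take-≤ {n} {xs} n≤ = trans (List.length-take n xs) (ℕ.m≤n⇒m⊓n≡m n≤)

module _ {A B : Set} (f : A → B) where

  -- Relative to the list because a coordinate projection is injective on the points of a suitable
  -- line, but not on the plane.
  InjectiveOn : List A → Set
  InjectiveOn xs = ∀ {x y} → x ∈ xs → y ∈ xs → f x ≡ f y → x ≡ y

  unique-map : ∀ {xs} → Unique xs → InjectiveOn xs → Unique (map f xs)
  unique-map []             _   = []
  unique-map (x∉xs ∷ xs!) inj =
    All.map⁺ (All.tabulate λ y∈xs eq → All.lookup x∉xs y∈xs (inj (here refl) (there y∈xs) eq))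
    ∷ unique-map xs! (λ x∈ y∈ → inj (there x∈) (there y∈))

  length≤-injection : ∀ {xs ys} → Unique xs → InjectiveOn xs → (∀ {x} → x ∈ xs → f x ∈ ys) →
    length xs ≤ length ys
  length≤-injection {xs} {ys} xs! inj into = begin
    length xs          ≡⟨ List.length-map f xs ⟨
    length (map f xs)  ≤⟨ unique-⊆⇒length≤ (unique-map xs! inj) image⊆ys ⟩
    length ys          ∎
    where
    open ℕ.≤-Reasoning
    image⊆ys : map f xs ⊆ ys
    image⊆ys y∈ with ∈-map⁻ f y∈
    ... | x , x∈xs , refl = into x∈xs

-- Finite sums of natural numbers and double counting.

∑ : ∀ {n} → (Fin n → ℕ) → ℕ
∑ = MonoidSum.sum ℕ.+-0-commutativeMonoid

∑-mono : ∀ {n} {f g : Fin n → ℕ} → (∀ i → f i ≤ g i) → ∑ f ≤ ∑ g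
∑-mono {zero}  f≤g = z≤n
∑-mono {suc n} f≤g = ℕ.+-mono-≤ (f≤g zero) (∑-mono (f≤g ∘ suc))

∑-const : ∀ n m → ∑ {n} (λ _ → m) ≡ n ℕ.* m
∑-const zero    m = refl
∑-const (suc n) m = cong (m ℕ.+_) (∑-const n m)

∑-≤ : ∀ {n m} {f : Fin n → ℕ} → (∀ i → f i ≤ m) → ∑ f ≤ n ℕ.* m
∑-≤ {n} {m} f≤ = ℕ.≤-trans (∑-mono f≤) (ℕ.≤-reflexive (∑-const n m))

∑-≥ : ∀ {n m} {f : Fin n → ℕ} → (∀ i → m ≤ f i) → n ℕ.* m ≤ ∑ f
∑-≥ {n} {m} m≤f = ℕ.≤-trans (ℕ.≤-reflexive (sym (∑-const n m))) (∑-mono m≤f)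

-- At most one term can exceed `B`, and that one is bounded by `A`. For a transversal against a grid
-- the exceptional index is that of the horizontal line.
∑-≤-exception : ∀ {n A B} {f : Fin (suc n) → ℕ} {P : Pred (Fin (suc n)) 0ℓ} → Decidable P →
  B ≤ A → (∀ {i j} → P i → P j → i ≡ j) → (∀ i → f i ≤ A) → (∀ i → ¬ P i → f i ≤ B) →
  ∑ f ≤ A ℕ.+ n ℕ.* B
∑-≤-exception {n} P? B≤A P-one f≤A f≤B with P? zero
... | yes P0 = ℕ.+-mono-≤ (f≤A zero) (∑-≤ λ i → f≤B (suc i) λ Pi → Fin.0≢1+n (P-one P0 Pi))
∑-≤-exception {zero} {A} {B} P? B≤A P-one f≤A f≤B | no ¬P0 = ℕ.+-monoˡ-≤ 0 (f≤A zero)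
∑-≤-exception {suc n} {A} {B} {f} P? B≤A P-one f≤A f≤B | no ¬P0 = begin
  f zero ℕ.+ ∑ (f ∘ suc)  ≤⟨ ℕ.+-mono-≤ (f≤B zero ¬P0) (∑-≤-exception (P? ∘ suc) B≤A (λ p p′ → Fin.suc-injective (P-one p p′)) (f≤A ∘ suc) (f≤B ∘ suc)) ⟩
  B ℕ.+ (A ℕ.+ n ℕ.* B)       ≡⟨ ℕ.+-assoc B A (n ℕ.* B) ⟨
  B ℕ.+ A ℕ.+ n ℕ.* B         ≡⟨ cong (ℕ._+ n ℕ.* B) (ℕ.+-comm B A) ⟩
  A ℕ.+ B ℕ.+ n ℕ.* B         ≡⟨ ℕ.+-assoc A B (n ℕ.* B) ⟩
  A ℕ.+ (B ℕ.+ n ℕ.* B)       ∎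
  where open ℕ.≤-Reasoning

∑-≥-exception : ∀ {n A B} {f : Fin (suc n) → ℕ} → ∀ i → A ≤ f i → (∀ j → B ≤ f j) → A ℕ.+ n ℕ.* B ≤ ∑ f
∑-≥-exception zero A≤ B≤ = ℕ.+-mono-≤ A≤ (∑-≥ (B≤ ∘ suc))
∑-≥-exception {suc n} {A} {B} {f} (suc i) A≤ B≤ = begin
  A ℕ.+ (B ℕ.+ n ℕ.* B)       ≡⟨ ℕ.+-assoc A B (n ℕ.* B) ⟨
  A ℕ.+ B ℕ.+ n ℕ.* B         ≡⟨ cong (ℕ._+ n ℕ.* B) (ℕ.+-comm A B) ⟩
  B ℕ.+ A ℕ.+ n ℕ.* B         ≡⟨ ℕ.+-assoc B A (n ℕ.* B) ⟩
  B ℕ.+ (A ℕ.+ n ℕ.* B)       ≤⟨ ℕ.+-mono-≤ (B≤ zero) (∑-≥-exception i A≤ (B≤ ∘ suc)) ⟩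
  f zero ℕ.+ ∑ (f ∘ suc)  ∎
  where open ℕ.≤-Reasoning

∑-pigeonhole : ∀ {n m} (f : Fin n → ℕ) → n ℕ.* m < ∑ f → ∃[ i ] m < f i
∑-pigeonhole {n} {m} f nm< with Fin.any? (λ i → m ℕ.<? f i)
... | yes found = found
... | no  none  = contradiction (∑-≤ λ i → ℕ.≮⇒≥ λ m<fi → none (i , m<fi)) (ℕ.<⇒≱ nm<)

module _ {A : Set} {n} {R : Fin n → Pred A 0ℓ} (R? : ∀ i → Decidable (R i)) where

  ∑-count : List A → ℕ
  ∑-count xs = ∑ λ i → length (filter (R? i) xs)

  filter-∷-≥ : ∀ i x xs → length (filter (R? i) xs) ≤ length (filter (R? i) (x ∷ xs))
  filter-∷-≥ i x xs with does (R? i x)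
  ... | true  = ℕ.n≤1+n _
  ... | false = ℕ.≤-refl

  filter-∷-> : ∀ i x xs → R i x → length (filter (R? i) xs) < length (filter (R? i) (x ∷ xs))
  filter-∷-> i x xs Rix rewrite dec-true (R? i x) Rix = ℕ.≤-refl

∑-mono-< : ∀ {n} {f g : Fin n → ℕ} → (∀ i → f i ≤ g i) → ∀ j → f j < g j → ∑ f < ∑ g
∑-mono-< f≤g zero    fj<gj = ℕ.+-mono-<-≤ fj<gj (∑-mono (f≤g ∘ suc))
∑-mono-< f≤g (suc j) fj<gj = ℕ.+-mono-≤-< (f≤g zero) (∑-mono-< (f≤g ∘ suc) j fj<gj)

∑-mono-all-< : ∀ {n} {f g : Fin n → ℕ} → (∀ i → f i < g i) → n ℕ.+ ∑ f ≤ ∑ g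
∑-mono-all-< {zero}  f<g = z≤n
∑-mono-all-< {suc n} {f} {g} f<g = begin
  suc (n ℕ.+ (f zero ℕ.+ ∑ (f ∘ suc)))  ≡⟨ cong suc (ℕ.+-assoc n _ _) ⟨
  suc (n ℕ.+ f zero ℕ.+ ∑ (f ∘ suc))    ≡⟨ cong (λ k → suc (k ℕ.+ ∑ (f ∘ suc))) (ℕ.+-comm n (f zero)) ⟩
  suc (f zero ℕ.+ n ℕ.+ ∑ (f ∘ suc))    ≡⟨ cong suc (ℕ.+-assoc (f zero) n _) ⟩
  suc (f zero) ℕ.+ (n ℕ.+ ∑ (f ∘ suc))  ≤⟨ ℕ.+-mono-≤ (f<g zero) (∑-mono-all-< (f<g ∘ suc)) ⟩
  g zero ℕ.+ ∑ (g ∘ suc)              ∎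
  where open ℕ.≤-Reasoning

module _ {A : Set} {n} {R : Fin n → Pred A 0ℓ} (R? : ∀ i → Decidable (R i)) (cover : ∀ x → ∃[ i ] R i x) where

  -- Each element of the list is counted at least once, at an index that covers it.
  ∑-count-cover : ∀ xs → length xs ≤ ∑-count R? xs
  ∑-count-cover []       = z≤n
  ∑-count-cover (x ∷ xs) = ℕ.≤-<-trans (∑-count-cover xs)
    (∑-mono-< (λ i → filter-∷-≥ R? i x xs) (proj₁ (cover x)) (filter-∷-> R? _ x xs (proj₂ (cover x))))

  -- The element `p` is counted at all n indices and every other one at least once, which gives |xs|
  -- - 1 + n; the `suc` on the right avoids the subtraction.
  ∑-count-pencil : ∀ {p xs} → p ∈ xs → (∀ i → R i p) → length xs ℕ.+ n ≤ suc (∑-count R? xs)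
  ∑-count-pencil {xs = x ∷ xs} (here refl) Rp = begin
    suc (length xs ℕ.+ n)          ≡⟨ cong suc (ℕ.+-comm (length xs) n) ⟩
    suc (n ℕ.+ length xs)          ≤⟨ s≤s (ℕ.+-monoʳ-≤ n (∑-count-cover xs)) ⟩
    suc (n ℕ.+ ∑-count R? xs)      ≤⟨ s≤s (∑-mono-all-< λ i → filter-∷-> R? i x xs (Rp i)) ⟩
    suc (∑-count R? (x ∷ xs))    ∎
    where open ℕ.≤-Reasoning
  ∑-count-pencil {xs = x ∷ xs} (there p∈) Rp = ℕ.≤-trans (s≤s (∑-count-pencil p∈ Rp))
    (s≤s (∑-mono-< (λ i → filter-∷-≥ R? i x xs) (proj₁ (cover x)) (filter-∷-> R? _ x xs (proj₂ (cover x)))))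

-- Finite fields: power sums, polynomial roots, blocking sets, characteristic two.

module FieldProperties {q : ℕ} (K : FiniteField q) where
  open FiniteField K

  commutativeRing : CommutativeRing _ _
  commutativeRing = record { isCommutativeRing = isCommutativeRing }

  open CommutativeRing commutativeRing public
    using ( _-_; +-identityʳ; +-identityˡ; *-identityʳ; *-identityˡ; zeroʳ; zeroˡ; -‿inverseʳ
          ; *-comm; semiring; commutativeSemiring; +-group)
  open IntegerCoefficients commutativeRing public using (solve; _:=_; _:+_; _:*_; _:-_; :-_; con)
  open GroupProperties +-group using (identityʳ-unique; x∙y⁻¹≈ε⇒x≈y)
  open SemiringExp semiring using (_^_)
  open CommutativeSemiringExp commutativeSemiring using (^-distrib-*)
  open SemiringMult semiring using (×1-homo-*) renaming (_×_ to _·_)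
  open SemiringSum semiring
    using (sum; sum-cong-≗; sum-permute; sum-remove; sum-replicate; sum-replicate-zero
          ; *-distribˡ-sum; *-distribʳ-sum; ∑-distrib-+)
  open ≡-Reasoning

  x-y≡0⇒x≡y : ∀ {x y} → x - y ≡ 0# → x ≡ y
  x-y≡0⇒x≡y = x∙y⁻¹≈ε⇒x≈y _ _

  x≡y⇒x-y≡0 : ∀ {x y} → x ≡ y → x - y ≡ 0#
  x≡y⇒x-y≡0 refl = -‿inverseʳ _

  *-zero-cancelˡ : ∀ {x y} → x ≢ 0# → x * y ≡ 0# → y ≡ 0#
  *-zero-cancelˡ {x} {y} x≢0 xy≡0 with inverse x x≢0
  ... | z , xz≡1 = begin
    y            ≡⟨ *-identityˡ y ⟨
    1# * y       ≡⟨ cong (_* y) xz≡1 ⟨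
    x * z * y    ≡⟨ solve 3 (λ x y z → x :* z :* y := z :* (x :* y)) refl x y z ⟩
    z * (x * y)  ≡⟨ cong (z *_) xy≡0 ⟩
    z * 0#       ≡⟨ zeroʳ z ⟩
    0#           ∎

  *-zero-cancelʳ : ∀ {x y} → y ≢ 0# → x * y ≡ 0# → x ≡ 0#
  *-zero-cancelʳ y≢0 xy≡0 = *-zero-cancelˡ y≢0 (trans (*-comm _ _) xy≡0)

  *-cancelˡ-≢0 : ∀ {x y z} → x ≢ 0# → x * y ≡ x * z → y ≡ z
  *-cancelˡ-≢0 {x} {y} {z} x≢0 xy≡xz = x-y≡0⇒x≡y (*-zero-cancelˡ x≢0 (trans
    (solve 3 (λ x y z → x :* (y :- z) := x :* y :- x :* z) refl x y z) (x≡y⇒x-y≡0 xy≡xz)))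

  element : Fin q → Carrier
  element = Inverse.to enumeration

  index : Carrier → Fin q
  index = Inverse.from enumeration

  element-index : ∀ x → element (index x) ≡ x
  element-index = Inverse.strictlyInverseˡ enumeration

  index-element : ∀ i → index (element i) ≡ i
  index-element = Inverse.strictlyInverseʳ enumeration

  element-injective : ∀ {i j} → element i ≡ element j → i ≡ j
  element-injective {i} {j} eq = trans (sym (index-element i)) (trans (cong index eq) (index-element j))

  elements : List Carrier
  elements = tabulate element

  elements-unique : Unique elements
  elements-unique = Unique.tabulate⁺ element-injective

  ∈-elements : ∀ x → x ∈ elements
  ∈-elements x = subst (_∈ elements) (element-index x) (∈-tabulate⁺ (index x))

  length-elements : length elements ≡ q
  length-elements = List.length-tabulate element

  unique⇒length≤q : ∀ {xs : List Carrier} → Unique xs → length xs ≤ q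
  unique⇒length≤q xs! = subst (_ ≤_) length-elements (unique-⊆⇒length≤ xs! λ {x} _ → ∈-elements x)

  1<q : 1 < q
  1<q = unique⇒length≤q ((0≢1 ∷ []) ∷ [] ∷ [])

  -- Sums over the field

  ∑ᴷ : (Carrier → Carrier) → Carrier
  ∑ᴷ f = sum (f ∘ element)

  ∑ᴷ-cong : ∀ {f g} → (∀ x → f x ≡ g x) → ∑ᴷ f ≡ ∑ᴷ g
  ∑ᴷ-cong f≗g = sum-cong-≗ (f≗g ∘ element)

  ∑ᴷ-reindex : ∀ (f : Carrier → Carrier) (σ : Carrier ↔ Carrier) → ∑ᴷ (f ∘ Inverse.to σ) ≡ ∑ᴷ f
  ∑ᴷ-reindex f σ = sym (trans (sum-permute (f ∘ element) (↔-trans enumeration (↔-trans σ (↔-sym enumeration))))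
    (∑ᴷ-cong λ x → cong f (element-index (Inverse.to σ x))))

  ∑ᴷ-zero : ∀ {f} → (∀ x → f x ≡ 0#) → ∑ᴷ f ≡ 0#
  ∑ᴷ-zero f≗0 = trans (∑ᴷ-cong f≗0) (sum-replicate-zero q)

  ∑ᴷ-+ : ∀ f g → ∑ᴷ (λ x → f x + g x) ≡ ∑ᴷ f + ∑ᴷ g
  ∑ᴷ-+ f g = ∑-distrib-+ (f ∘ element) (g ∘ element)

  ∑ᴷ-*ˡ : ∀ c f → ∑ᴷ (λ x → c * f x) ≡ c * ∑ᴷ f
  ∑ᴷ-*ˡ c f = sym (*-distribˡ-sum c (f ∘ element))

  ∑ᴷ-*ʳ : ∀ c f → ∑ᴷ (λ x → f x * c) ≡ ∑ᴷ f * c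
  ∑ᴷ-*ʳ c f = sym (*-distribʳ-sum c (f ∘ element))

  sum-single : ∀ {n} (t : Fin n → Carrier) i → (∀ j → j ≢ i → t j ≡ 0#) → sum t ≡ t i
  sum-single {suc n} t i t≡0 = begin
    sum t                           ≡⟨ sum-remove {i = i} t ⟩
    t i + sum (λ j → t (punchIn i j))  ≡⟨ cong (t i +_) (sum-cong-≗ λ j → t≡0 (punchIn i j) (Fin.punchInᵢ≢i i j)) ⟩
    t i + sum {n} (λ _ → 0#)        ≡⟨ cong (t i +_) (sum-replicate-zero n) ⟩
    t i + 0#                        ≡⟨ +-identityʳ _ ⟩
    t i                             ∎

  ∑ᴷ-single : ∀ f → (∀ x → x ≢ 0# → f x ≡ 0#) → ∑ᴷ f ≡ f 0#
  ∑ᴷ-single f f≡0 = trans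
    (sum-single (f ∘ element) (index 0#) λ j j≢ → f≡0 (element j) λ ej≡0 → j≢ (trans (sym (index-element j)) (cong index ej≡0)))
    (cong f (element-index 0#))

  translation : Carrier → Carrier ↔ Carrier
  translation c = mk↔ₛ′ (_+ c) (_- c)
    (λ x → solve 2 (λ x c → (x :- c) :+ c := x) refl x c)
    (λ x → solve 2 (λ x c → (x :+ c) :- c := x) refl x c)

  scaling : ∀ {g} → g ≢ 0# → Carrier ↔ Carrier
  scaling {g} g≢0 with inverse g g≢0
  ... | h , gh≡1 = mk↔ₛ′ (g *_) (h *_)
    (λ x → trans (solve 3 (λ g h x → g :* (h :* x) := g :* h :* x) refl g h x) (cancel x))
    (λ x → trans (solve 3 (λ g h x → h :* (g :* x) := g :* h :* x) refl g h x) (cancel x))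
    where
    cancel : ∀ x → g * h * x ≡ x
    cancel x = trans (cong (_* x) gh≡1) (*-identityˡ x)

  -- Translation by 1 permutes K, so the sum of all x equals the sum of all x + 1, and the
  -- difference of the two is the sum of the ones.
  ∑ᴷ-1 : ∑ᴷ (λ _ → 1#) ≡ 0#
  ∑ᴷ-1 = identityʳ-unique (∑ᴷ (λ x → x)) _ (trans (sym (∑ᴷ-+ (λ x → x) (λ _ → 1#))) (∑ᴷ-reindex (λ x → x) (translation 1#)))

  -- Roots of monic polynomials

  -- A certificate in Horner form that a function is given by a monic polynomial of the stated
  -- degree. The equations are pointwise, so no function extensionality is involved.
  data Monic : ℕ → (Carrier → Carrier) → Set where
    one    : ∀ {f} → (∀ x → f x ≡ 1#) → Monic 0 f
    horner : ∀ {n f g} c → Monic n g → (∀ x → f x ≡ x * g x + c) → Monic (suc n) f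

  -- Synthetic division by x - r carried out on the Horner form; the remainder is `f r`.
  factor : ∀ {n f} → Monic (suc n) f → ∀ r → ∃[ g ] Monic n g × (∀ x → f x ≡ f r + (x - r) * g x)
  factor {zero} {f} (horner {g = g} c (one g≡1) f≡) r = (λ _ → 1#) , one (λ _ → refl) , λ x → begin
    f x                           ≡⟨ f≡ x ⟩
    x * g x + c                   ≡⟨ cong (λ y → x * y + c) (g≡1 x) ⟩
    x * 1# + c                    ≡⟨ solve 3 (λ x r c → x :* con (1 , 0) :+ c := (r :* con (1 , 0) :+ c) :+ (x :- r) :* con (1 , 0)) refl x r c ⟩
    (r * 1# + c) + (x - r) * 1#   ≡⟨ cong (λ y → (r * y + c) + (x - r) * 1#) (g≡1 r) ⟨
    (r * g r + c) + (x - r) * 1#  ≡⟨ cong (_+ (x - r) * 1#) (f≡ r) ⟨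
    f r + (x - r) * 1#            ∎
  factor {suc n} {f} (horner {g = g} c g-monic f≡) r with factor g-monic r
  ... | h , h-monic , g≡ = (λ x → x * h x + g r) , horner (g r) h-monic (λ _ → refl) , λ x → begin
    f x                                          ≡⟨ f≡ x ⟩
    x * g x + c                                  ≡⟨ cong (λ y → x * y + c) (g≡ x) ⟩
    x * (g r + (x - r) * h x) + c                ≡⟨ solve 5 (λ x r c y z → x :* (y :+ (x :- r) :* z) :+ c := (r :* y :+ c) :+ (x :- r) :* (x :* z :+ y)) refl x r c (g r) (h x) ⟩
    (r * g r + c) + (x - r) * (x * h x + g r)    ≡⟨ cong (_+ (x - r) * (x * h x + g r)) (f≡ r) ⟨
    f r + (x - r) * (x * h x + g r)              ∎

  -- After a root r is split off, every other root s is a root of the quotient, since s - r is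
  -- nonzero.
  roots-≤-degree : ∀ {n f} → Monic n f → ∀ {rs} → Unique rs → All (λ r → f r ≡ 0#) rs → length rs ≤ n
  roots-≤-degree _ [] [] = z≤n
  roots-≤-degree (one f≡1) (_ ∷ _) (fr≡0 ∷ _) = contradiction (trans (sym fr≡0) (f≡1 _)) 0≢1
  roots-≤-degree {suc n} {f} f-monic@(horner _ _ _) {r ∷ rs} (r∉rs ∷ rs!) (fr≡0 ∷ roots) with factor f-monic r
  ... | g , g-monic , f≡ = s≤s (roots-≤-degree g-monic rs! (All.zipWith root (r∉rs , roots)))
    where
    root : ∀ {s} → r ≢ s × f s ≡ 0# → g s ≡ 0#
    root {s} (r≢s , fs≡0) = *-zero-cancelˡ (λ s-r≡0 → r≢s (sym (x-y≡0⇒x≡y s-r≡0))) (begin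
      (s - r) * g s        ≡⟨ +-identityˡ _ ⟨
      0# + (s - r) * g s   ≡⟨ cong (_+ (s - r) * g s) fr≡0 ⟨
      f r + (s - r) * g s  ≡⟨ f≡ s ⟨
      f s                  ≡⟨ fs≡0 ⟩
      0#                   ∎)

  power-monic : ∀ n → Monic n (_^ n)
  power-monic zero    = one λ _ → refl
  power-monic (suc n) = horner 0# (power-monic n) λ _ → sym (+-identityʳ _)

  -- The polynomial x(xⁿ⁺¹ - 1) is monic of degree n + 2 < q, so some element of K is not a root of
  -- it.
  ∃-power≢1 : ∀ n → suc (suc n) < q → ∃[ g ] g ≢ 0# × g ^ suc n ≢ 1#
  ∃-power≢1 n 2+n<q with Fin.¬∀⟶∃¬ q (λ i → f (element i) ≡ 0#) (λ i → f (element i) ≟ 0#) ¬all-roots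
    where
    f : Carrier → Carrier
    f x = x * (x ^ suc n - 1#)
    f-monic : Monic (suc (suc n)) f
    f-monic = horner 0# (horner (- 1#) (power-monic n) λ _ → refl) λ _ → sym (+-identityʳ _)
    ¬all-roots : ¬ (∀ i → f (element i) ≡ 0#)
    ¬all-roots all = ℕ.<⇒≱ 2+n<q (subst (_≤ suc (suc n)) length-elements
      (roots-≤-degree f-monic elements-unique (All.tabulate λ {x} _ → subst (λ y → f y ≡ 0#) (element-index x) (all (index x)))))
  ... | i , fg≢0 = element i
    , (λ g≡0 → fg≢0 (trans (cong (_* (element i ^ suc n - 1#)) g≡0) (zeroˡ _)))
    , (λ gⁿ≡1 → fg≢0 (trans (cong (element i *_) (x≡y⇒x-y≡0 gⁿ≡1)) (zeroʳ _)))

  -- Scaling by `g` permutes K and multiplies the sum by a power of `g` other than 1, so the sum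
  -- vanishes. Exponent 0 is the sum of the ones.
  power-sum : ∀ n → suc n < q → ∑ᴷ (_^ n) ≡ 0#
  power-sum zero    _     = ∑ᴷ-1
  power-sum (suc n) 2+n<q with ∃-power≢1 n 2+n<q
  ... | g , g≢0 , gⁿ≢1 = *-zero-cancelˡ (gⁿ≢1 ∘ x-y≡0⇒x≡y) (begin
    (g ^ suc n - 1#) * S        ≡⟨ solve 2 (λ y s → (y :- con (1 , 0)) :* s := y :* s :- s) refl (g ^ suc n) S ⟩
    g ^ suc n * S - S           ≡⟨ x≡y⇒x-y≡0 (begin
      g ^ suc n * S                      ≡⟨ ∑ᴷ-*ˡ (g ^ suc n) (_^ suc n) ⟨
      ∑ᴷ (λ x → g ^ suc n * x ^ suc n)   ≡⟨ ∑ᴷ-cong (λ x → ^-distrib-* g x (suc n)) ⟨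
      ∑ᴷ (λ x → (g * x) ^ suc n)         ≡⟨ ∑ᴷ-reindex (_^ suc n) (scaling g≢0) ⟩
      S                                  ∎) ⟩
    0#                          ∎)
    where
    S = ∑ᴷ (_^ suc n)

  -- Blocking sets

  -- The points are parameters and the line coefficients `a`, `b` are the variables; in these the
  -- degree is at most the number of points.
  ∏-forms : List (Carrier × Carrier) → Carrier → Carrier → Carrier
  ∏-forms []             a b = 1#
  ∏-forms ((x , y) ∷ ps) a b = (1# - (a * x + b * y)) * ∏-forms ps a b

  ∑² : (Carrier → Carrier → Carrier) → Carrier
  ∑² f = ∑ᴷ λ a → ∑ᴷ (f a)

  ∑²-cong : ∀ {f g} → (∀ a b → f a b ≡ g a b) → ∑² f ≡ ∑² g
  ∑²-cong f≗g = ∑ᴷ-cong λ a → ∑ᴷ-cong (f≗g a)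

  ∑²-+ : ∀ f g → ∑² (λ a b → f a b + g a b) ≡ ∑² f + ∑² g
  ∑²-+ f g = trans (∑ᴷ-cong λ a → ∑ᴷ-+ (f a) (g a)) (∑ᴷ-+ (λ a → ∑ᴷ (f a)) (λ a → ∑ᴷ (g a)))

  ∑²-*ˡ : ∀ c f → ∑² (λ a b → c * f a b) ≡ c * ∑² f
  ∑²-*ˡ c f = trans (∑ᴷ-cong λ a → ∑ᴷ-*ˡ c (f a)) (∑ᴷ-*ˡ c λ a → ∑ᴷ (f a))

  -- The factor `1#` is the empty product `∏-forms [] a b`, so this is the base case of
  -- `∑²-∏-forms`.
  ∑²-product : ∀ (f g : Carrier → Carrier) → ∑² (λ a b → f a * (g b * 1#)) ≡ ∑ᴷ f * ∑ᴷ g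
  ∑²-product f g = begin
    ∑ᴷ (λ a → ∑ᴷ λ b → f a * (g b * 1#))  ≡⟨ ∑²-cong (λ a b → cong (f a *_) (*-identityʳ (g b))) ⟩
    ∑ᴷ (λ a → ∑ᴷ λ b → f a * g b)         ≡⟨ ∑ᴷ-cong (λ a → ∑ᴷ-*ˡ (f a) g) ⟩
    ∑ᴷ (λ a → f a * ∑ᴷ g)                 ≡⟨ ∑ᴷ-*ʳ (∑ᴷ g) f ⟩
    ∑ᴷ f * ∑ᴷ g                           ∎

  low-exponent : ∀ i j → i ℕ.+ j < 2 ℕ.* (q ℕ.∸ 1) → suc i < q ⊎ suc j < q
  low-exponent i j i+j< with suc i ℕ.<? q | suc j ℕ.<? q
  ... | yes i<q | _       = inj₁ i<q
  ... | no  _   | yes j<q = inj₂ j<q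
  ... | no  i≮q | no  j≮q = contradiction i+j< (ℕ.≤⇒≯ (ℕ.+-mono-≤ (q-1≤ i≮q) (subst (_≤ j) (sym (ℕ.+-identityʳ _)) (q-1≤ j≮q))))
    where
    q-1≤ : ∀ {k} → ¬ suc k < q → q ℕ.∸ 1 ≤ k
    q-1≤ k≮q = ℕ.∸-monoˡ-≤ 1 (ℕ.≮⇒≥ k≮q)

  -- A polynomial in two variables of degree below 2(q − 1) sums to zero over K²,
  -- since each of its monomials has an exponent below q − 1.
  ∑²-∏-forms : ∀ ps i j → length ps ℕ.+ (i ℕ.+ j) < 2 ℕ.* (q ℕ.∸ 1) →
    ∑² (λ a b → a ^ i * (b ^ j * ∏-forms ps a b)) ≡ 0#
  ∑²-∏-forms [] i j deg< with low-exponent i j deg<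
  ... | inj₁ i<q = trans (∑²-product (_^ i) (_^ j)) (trans (cong (_* ∑ᴷ (_^ j)) (power-sum i i<q)) (zeroˡ _))
  ... | inj₂ j<q = trans (∑²-product (_^ i) (_^ j)) (trans (cong (∑ᴷ (_^ i) *_) (power-sum j j<q)) (zeroʳ _))
  ∑²-∏-forms ((x , y) ∷ ps) i j deg< = begin
    -- Multiplying out one linear factor gives three sums over the remaining product, in which `i`,
    -- `j` or neither exponent is raised by one; the degree bound survives in each.
    ∑² (λ a b → a ^ i * (b ^ j * ((1# - (a * x + b * y)) * P a b)))  ≡⟨ ∑²-cong (λ a b → expand a b (a ^ i) (b ^ j) (P a b)) ⟩
    ∑² (λ a b → m i j a b + (- x * m (suc i) j a b + - y * m i (suc j) a b))
      ≡⟨ ∑²-+ (m i j) (λ a b → - x * m (suc i) j a b + - y * m i (suc j) a b) ⟩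
    ∑² (m i j) + ∑² (λ a b → - x * m (suc i) j a b + - y * m i (suc j) a b)
      ≡⟨ cong (∑² (m i j) +_) (trans (∑²-+ (λ a b → - x * m (suc i) j a b) (λ a b → - y * m i (suc j) a b)) (cong₂ _+_ (∑²-*ˡ (- x) (m (suc i) j)) (∑²-*ˡ (- y) (m i (suc j))))) ⟩
    ∑² (m i j) + (- x * ∑² (m (suc i) j) + - y * ∑² (m i (suc j)))
      ≡⟨ cong₂ _+_ (∑²-∏-forms ps i j (ℕ.<-trans (ℕ.n<1+n _) deg<))
           (cong₂ (λ s t → - x * s + - y * t)
             (∑²-∏-forms ps (suc i) j (subst (_< 2 ℕ.* (q ℕ.∸ 1)) (sym (ℕ.+-suc (length ps) (i ℕ.+ j))) deg<))
             (∑²-∏-forms ps i (suc j) (subst (_< 2 ℕ.* (q ℕ.∸ 1)) (sym (trans (cong (length ps ℕ.+_) (ℕ.+-suc i j)) (ℕ.+-suc (length ps) (i ℕ.+ j)))) deg<))) ⟩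
    0# + (- x * 0# + - y * 0#)  ≡⟨ solve 2 (λ x y → con (0 , 0) :+ ((:- x) :* con (0 , 0) :+ (:- y) :* con (0 , 0)) := con (0 , 0)) refl x y ⟩
    0#  ∎
    where
    P = ∏-forms ps
    m : ℕ → ℕ → Carrier → Carrier → Carrier
    m i j a b = a ^ i * (b ^ j * P a b)
    expand : ∀ a b s t p → s * (t * ((1# - (a * x + b * y)) * p)) ≡
      s * (t * p) + (- x * (a * s * (t * p)) + - y * (s * (b * t * p)))
    expand a b s t p = solve 7 (λ a b s t p x y →
      s :* (t :* ((con (1 , 0) :- (a :* x :+ b :* y)) :* p)) :=
      s :* (t :* p) :+ ((:- x) :* (a :* s :* (t :* p)) :+ (:- y) :* (s :* (b :* t :* p)))) refl a b s t p x y

  ∏-forms-0 : ∀ ps → ∏-forms ps 0# 0# ≡ 1#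
  ∏-forms-0 []             = refl
  ∏-forms-0 ((x , y) ∷ ps) = trans (cong ((1# - (0# * x + 0# * y)) *_) (∏-forms-0 ps))
    (solve 2 (λ x y → (con (1 , 0) :- (con (0 , 0) :* x :+ con (0 , 0) :* y)) :* con (1 , 0) := con (1 , 0)) refl x y)

  ∏-forms-root : ∀ {ps a b x y} → (x , y) ∈ ps → a * x + b * y ≡ 1# → ∏-forms ps a b ≡ 0#
  ∏-forms-root {_ ∷ ps} {a} {b} (here refl) eq = trans (cong (_* ∏-forms ps a b) (x≡y⇒x-y≡0 (sym eq))) (zeroˡ _)
  ∏-forms-root {(x , y) ∷ _} {a} {b} (there p∈) eq = trans (cong ((1# - (a * x + b * y)) *_) (∏-forms-root p∈ eq)) (zeroʳ _)

  open AG K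

  Blocking : List Point → Set
  Blocking B = ∀ L → ∃[ p ] p ∈ B × On L p

  blocking-size : ∀ {B} → Blocking B → 2 ℕ.* (q ℕ.∸ 1) < length B
  blocking-size {[]} blocking with blocking record { a = 1# ; b = 0# ; c = 0# ; nondegenerate = λ (1≡0 , _) → 0≢1 (sym 1≡0) }
  ... | _ , () , _
  blocking-size {(x₀ , y₀) ∷ B} blocking with 2 ℕ.* (q ℕ.∸ 1) ℕ.<? suc (length B)
  ... | yes <B = <B
  ... | no  ≮B = contradiction (trans (sym sum≡0) sum≡1) 0≢1
    where
    shift : Point → Point
    -- The point (x₀ , y₀) of the blocking set is moved to the origin and contributes no factor to
    -- the product.
    shift (x , y) = x - x₀ , y - y₀
    ps = map shift B
    -- The factors `1#` are zeroth powers, so that `f` is literally the summand of `∑²-∏-forms` with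
    -- both exponents 0.
    f : Carrier → Carrier → Carrier
    f a b = 1# * (1# * ∏-forms ps a b)

    sum≡0 : ∑² f ≡ 0#
    sum≡0 = ∑²-∏-forms ps 0 0 (subst (_< _) (sym (trans (ℕ.+-identityʳ _) (List.length-map shift B))) (ℕ.≮⇒≥ ≮B))

    f-zero : ∀ a b → ¬ (a ≡ 0# × b ≡ 0#) → f a b ≡ 0#
    -- This line misses (x₀ , y₀), so it is blocked by another point, whose shifted factor vanishes
    -- at (a , b).
    f-zero a b ab≢0 with blocking record { a = a ; b = b ; c = a * x₀ + b * y₀ + 1# ; nondegenerate = ab≢0 }
    ... | _ , here refl , on = contradiction (identityʳ-unique _ 1# (sym on)) (0≢1 ∘ sym)
    ... | (x , y) , there p∈ , on = trans (cong (λ z → 1# * (1# * z)) (∏-forms-root (∈-map⁺ shift p∈) (begin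
      a * (x - x₀) + b * (y - y₀)                         ≡⟨ solve 6 (λ a b x y x₀ y₀ → a :* (x :- x₀) :+ b :* (y :- y₀) := (a :* x :+ b :* y) :- (a :* x₀ :+ b :* y₀)) refl a b x y x₀ y₀ ⟩
      (a * x + b * y) - (a * x₀ + b * y₀)                 ≡⟨ cong (_- (a * x₀ + b * y₀)) on ⟩
      (a * x₀ + b * y₀ + 1#) - (a * x₀ + b * y₀)          ≡⟨ solve 1 (λ z → (z :+ con (1 , 0)) :- z := con (1 , 0)) refl (a * x₀ + b * y₀) ⟩
      1#                                                  ∎)))
      (trans (cong (1# *_) (zeroʳ 1#)) (zeroʳ 1#))

    sum≡1 : ∑² f ≡ 1#
    sum≡1 = begin
      ∑ᴷ (λ a → ∑ᴷ (f a))  ≡⟨ ∑ᴷ-single _ (λ a a≢0 → ∑ᴷ-zero λ b → f-zero a b (a≢0 ∘ proj₁)) ⟩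
      ∑ᴷ (f 0#)            ≡⟨ ∑ᴷ-single _ (λ b b≢0 → f-zero 0# b (b≢0 ∘ proj₂)) ⟩
      f 0# 0#              ≡⟨ cong (λ z → 1# * (1# * z)) (∏-forms-0 ps) ⟩
      1# * (1# * 1#)       ≡⟨ trans (*-identityˡ _) (*-identityˡ _) ⟩
      1#                   ∎

  -- x ↦ x² − x takes the value 0 at both 0 and 1, hence it is not surjective.
  ∃-irreducible : ∃[ c ] (∀ x → x * x - x ≢ c)
  ∃-irreducible with Fin.¬∀⟶∃¬ q (λ i → ∃[ j ] h (element j) ≡ element i) (λ i → Fin.any? λ j → h (element j) ≟ element i) ¬surjective
    where
    h : Carrier → Carrier
    h x = x * x - x
    h0≡0 : h 0# ≡ 0#
    h0≡0 = solve 0 (con (0 , 0) :* con (0 , 0) :- con (0 , 0) := con (0 , 0)) refl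
    h1≡0 : h 1# ≡ 0#
    h1≡0 = solve 0 (con (1 , 0) :* con (1 , 0) :- con (1 , 0) := con (0 , 0)) refl
    ¬surjective : ¬ (∀ i → ∃[ j ] h (element j) ≡ element i)
    -- A section of `h` has q distinct values, and of the two roots 0 and 1 at most one is the
    -- chosen preimage of 0. The other root is missed and would be element number q + 1.
    ¬surjective surjective = ℕ.1+n≰n (subst (λ k → suc k ≤ q)
      (trans (List.length-map section elements) length-elements) (unique⇒length≤q (proj₂ missed)))
      where
      section : Carrier → Carrier
      section x = element (proj₁ (surjective (index x)))
      h-section : ∀ x → h (section x) ≡ x
      h-section x = trans (proj₂ (surjective (index x))) (element-index x)
      section-injective : ∀ {x y} → section x ≡ section y → x ≡ y
      section-injective {x} {y} eq = trans (sym (h-section x)) (trans (cong h eq) (h-section y))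
      missed-by : ∀ {z} → h z ≡ 0# → section 0# ≢ z → Unique (z ∷ map section elements)
      missed-by {z} hz≡0 s0≢z = All.tabulate z∉ ∷ Unique.map⁺ section-injective elements-unique
        where
        z∉ : ∀ {y} → y ∈ map section elements → z ≢ y
        z∉ y∈ z≡y with ∈-map⁻ section y∈
        ... | x , _ , refl = s0≢z (trans (cong section (trans (sym hz≡0) (trans (cong h z≡y) (h-section x)))) (sym z≡y))
      missed : ∃[ z ] Unique (z ∷ map section elements)
      missed with section 0# ≟ 0#
      ... | no  s0≢0 = 0# , missed-by h0≡0 s0≢0
      ... | yes s0≡0 = 1# , missed-by h1≡0 λ s0≡1 → 0≢1 (trans (sym s0≡0) s0≡1)
  ... | i , missed = element i , λ x eq → missed (index x , trans (cong (λ y → y * y - y) (element-index x)) eq)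

  2∣p^k⇒p≡2 : ∀ {p} k → Prime p → 2 ∣ p ℕ.^ k → 2 ≡ p
  2∣p^k⇒p≡2 zero p-prime 2∣1 with () ← ∣1⇒≡1 2∣1
  2∣p^k⇒p≡2 {p} (suc k) p-prime 2∣ with euclidsLemma p (p ℕ.^ k) prime[2] 2∣
  ... | inj₂ 2∣p^k = 2∣p^k⇒p≡2 k p-prime 2∣p^k
  ... | inj₁ 2∣p with prime⇒irreducible p-prime 2∣p
  ...   | inj₂ 2≡p = 2≡p

  -- If 1 + 1 were nonzero, the factors 1 + 1 could be cancelled one at a time until 1 = 0 remained.
  2^k·1≡0⇒1+1≡0 : ∀ k → (2 ℕ.^ k) · 1# ≡ 0# → 1# + 1# ≡ 0#
  2^k·1≡0⇒1+1≡0 zero    eq = contradiction (sym (trans (sym (+-identityʳ 1#)) eq)) 0≢1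
  2^k·1≡0⇒1+1≡0 (suc k) eq with (1# + 1#) ≟ 0#
  ... | yes 2≡0 = 2≡0
  ... | no  2≢0 = 2^k·1≡0⇒1+1≡0 k (*-zero-cancelˡ 2≢0 (begin
    (1# + 1#) * ((2 ℕ.^ k) · 1#)         ≡⟨ cong (λ y → (1# + y) * ((2 ℕ.^ k) · 1#)) (+-identityʳ 1#) ⟨
    (2 · 1#) * ((2 ℕ.^ k) · 1#)          ≡⟨ ×1-homo-* 2 (2 ℕ.^ k) ⟨
    (2 ℕ.^ suc k) · 1#                   ≡⟨ eq ⟩
    0#                                   ∎))

  -- An even prime power is a power of 2, and the sum of the ones over K gives q · 1 = 0.
  even⇒1+1≡0 : IsPrimePower q → 2 ∣ q → 1# + 1# ≡ 0#
  even⇒1+1≡0 (p , k , p-prime , _ , q≡p^k) 2∣q with refl ← 2∣p^k⇒p≡2 k p-prime (subst (2 ∣_) q≡p^k 2∣q) =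
    2^k·1≡0⇒1+1≡0 k (subst (λ n → n · 1# ≡ 0#) q≡p^k (trans (sym (sum-replicate q)) ∑ᴷ-1))

-- Parallel classes of the affine plane and lower bounds for weights.

module Plane {q : ℕ} (K : FiniteField q) where
  open FiniteField K
  open FieldProperties K
  open AG K
  open Line

  -- The transversal that the lower bound supplies for the extremal arc attains the upper bound
  -- there, so the maximum weight of this arc is exactly `m`.
  ℓ-intro : ∀ {u n m} → (∀ F → IsArc u n F → ∃[ T ] m ≤ weight F T) →
    (∃[ F ] IsArc u n F × (∀ T → weight F T ≤ m)) → ℓ⟨ u ∶ n ⟩≡ m
  ℓ-intro lower (F , arc , upper) =
      (F , arc , (proj₁ T , ℕ.≤-antisym (upper (proj₁ T)) (proj₂ T)) , λ { _ (T , refl) → upper T })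
    , λ k (G , G-arc , _ , max) → let (T , m≤) = lower G G-arc in ℕ.≤-trans m≤ (max (weight G T) (T , refl))
    where
    T = lower F arc

  -- Directions and parallel classes

  -- The q + 1 points at infinity: `zero` is the vertical direction, `suc i` the direction of slope
  -- `element i`.
  dx dy : Fin (suc q) → Carrier
  dx zero    = 0#
  dx (suc _) = 1#
  dy zero    = 1#
  dy (suc i) = element i

  det : Fin (suc q) → Fin (suc q) → Carrier
  det d e = dx d * dy e - dx e * dy d

  det≢0 : ∀ {d e} → d ≢ e → det d e ≢ 0#
  det≢0 {zero}  {zero}  d≢e _    = d≢e refl
  det≢0 {zero}  {suc j} _   eq   = 0≢1 (trans
    (sym eq′) (solve 1 (λ m → :- (con (0 , 0) :* m :- con (1 , 0) :* con (1 , 0)) := con (1 , 0)) refl (element j)))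
    where
    eq′ : - det zero (suc j) ≡ 0#
    eq′ = trans (cong -_ eq) (solve 0 (:- con (0 , 0) := con (0 , 0)) refl)
  det≢0 {suc i} {zero}  _   eq   = 0≢1 (trans
    (sym eq) (solve 1 (λ m → con (1 , 0) :* con (1 , 0) :- con (0 , 0) :* m := con (1 , 0)) refl (element i)))
  det≢0 {suc i} {suc j} d≢e eq   = d≢e (cong suc (sym (element-injective (x-y≡0⇒x≡y (trans
    (solve 2 (λ m n → n :- m := con (1 , 0) :* n :- con (1 , 0) :* m) refl (element i) (element j)) eq)))))

  direction≢0 : ∀ d → ¬ (dx d ≡ 0# × dy d ≡ 0#)
  direction≢0 zero    (_ , 1≡0) = 0≢1 (sym 1≡0)
  direction≢0 (suc i) (1≡0 , _) = 0≢1 (sym 1≡0)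

  -x≡0⇒x≡0 : ∀ {x} → - x ≡ 0# → x ≡ 0#
  -x≡0⇒x≡0 {x} -x≡0 = trans (solve 1 (λ x → x := con (0 , 0) :- (:- x)) refl x) (trans (cong (λ y → 0# - y) -x≡0) (-‿inverseʳ 0#))

  classLine : Fin (suc q) → Carrier → Line
  classLine d c = record { a = dy d ; b = - dx d ; c = c ; nondegenerate = λ (a≡0 , b≡0) → direction≢0 d (-x≡0⇒x≡0 b≡0 , a≡0) }

  -- Cramer's rule; `det d e` is the determinant of the two equations.
  meet : ∀ {d e} → d ≢ e → ∀ c c′ → ∃[ p ] On (classLine d c) p × On (classLine e c′) p
  meet {d} {e} d≢e c c′ with inverse (det d e) (det≢0 d≢e)
  ... | D⁻¹ , D*D⁻¹≡1 = ((dx d * c′ - dx e * c) * D⁻¹ , (dy d * c′ - dy e * c) * D⁻¹)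
    , on (dx d) (dy d) c (solve 6 (λ a b a′ b′ c c′ →
        b :* (a :* c′ :- a′ :* c) :- a :* (b :* c′ :- b′ :* c) := c :* (a :* b′ :- a′ :* b)) refl (dx d) (dy d) (dx e) (dy e) c c′)
    , on (dx e) (dy e) c′ (solve 6 (λ a b a′ b′ c c′ →
        b′ :* (a :* c′ :- a′ :* c) :- a′ :* (b :* c′ :- b′ :* c) := c′ :* (a :* b′ :- a′ :* b)) refl (dx d) (dy d) (dx e) (dy e) c c′)
    where
    open ≡-Reasoning
    on : ∀ a b z {x y} → b * x - a * y ≡ z * det d e → b * (x * D⁻¹) + (- a) * (y * D⁻¹) ≡ z
    on a b z {x} {y} eq = begin
      b * (x * D⁻¹) + (- a) * (y * D⁻¹)  ≡⟨ solve 5 (λ a b x y i → b :* (x :* i) :+ (:- a) :* (y :* i) := (b :* x :- a :* y) :* i) refl a b x y D⁻¹ ⟩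
      (b * x - a * y) * D⁻¹              ≡⟨ cong (_* D⁻¹) eq ⟩
      z * det d e * D⁻¹                  ≡⟨ solve 3 (λ z D i → z :* D :* i := z :* (D :* i)) refl z (det d e) D⁻¹ ⟩
      z * (det d e * D⁻¹)                ≡⟨ trans (cong (z *_) D*D⁻¹≡1) (*-identityʳ z) ⟩
      z                                  ∎

  classTransversal : (Fin (suc q) → Carrier) → Transversal
  classTransversal γ = record
    { line        = λ d → classLine d (γ d)
    ; nonparallel = λ d e d≢e → λ
      -- If the two lines had the same points, the point where the first meets the next level of
      -- class `e` would have both levels `γ e` and `γ e + 1#`.
      { (inj₁ (d⊆e , _)) → let (p , on-d , on-e) = meet d≢e (γ d) (γ e + 1#) in
          0≢1 (sym (x+1≡x⇒1≡0 (trans (sym on-e) (d⊆e on-d))))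
      ; (inj₂ disjoint)  → disjoint (proj₂ (meet d≢e (γ d) (γ e)))
      }
    }
    where
    x+1≡x⇒1≡0 : ∀ {x} → x + 1# ≡ x → 1# ≡ 0#
    x+1≡x⇒1≡0 {x} eq = trans (solve 1 (λ x → con (1 , 0) := (x :+ con (1 , 0)) :- x) refl x) (x≡y⇒x-y≡0 eq)

  -- Selects the line of class `d` through a point; that `classLine d (level d p)` contains `p`
  -- holds by `refl`.
  level : Fin (suc q) → Point → Carrier
  level d (x , y) = dy d * x + (- dx d) * y

  ∃-class : ∀ u v → ¬ (u ≡ 0# × v ≡ 0#) → ∃[ d ] ∃[ k ] k ≢ 0# × u ≡ k * dx d × v ≡ k * dy d
  ∃-class u v uv≢0 with u ≟ 0#
  ... | yes u≡0 = zero , v , (λ v≡0 → uv≢0 (u≡0 , v≡0)) , trans u≡0 (sym (zeroʳ v)) , sym (*-identityʳ v)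
  ... | no  u≢0 with inverse u u≢0
  ...   | i , ui≡1 = suc (index (v * i)) , u , u≢0 , sym (*-identityʳ u) , sym (begin
    u * element (index (v * i))  ≡⟨ cong (u *_) (element-index _) ⟩
    u * (v * i)                  ≡⟨ solve 3 (λ u v i → u :* (v :* i) := v :* (u :* i)) refl u v i ⟩
    v * (u * i)                  ≡⟨ cong (v *_) ui≡1 ⟩
    v * 1#                       ≡⟨ *-identityʳ v ⟩
    v                            ∎)
    where open ≡-Reasoning

  -- This makes the pencil of `p` a cover of the plane, as `∑-count-pencil` requires. The class is
  -- the direction from `p` to `p′`, or `zero` if the first coordinates agree.
  joining : ∀ p p′ → ∃[ d ] On (classLine d (level d p)) p′
  joining (x , y) (x′ , y′) with x ≟ x′
  ... | yes refl = zero , solve 3 (λ x y y′ → con (1 , 0) :* x :+ (:- con (0 , 0)) :* y′ := con (1 , 0) :* x :+ (:- con (0 , 0)) :* y) refl x y y′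
  ... | no x≢x′ with ∃-class (x′ - x) (y′ - y) (λ (u≡0 , _) → x≢x′ (sym (x-y≡0⇒x≡y u≡0)))
  ...   | d , k , _ , u≡ , v≡ = d , x-y≡0⇒x≡y (begin
    level d (x′ , y′) - level d (x , y)          ≡⟨ solve 6 (λ x y x′ y′ a b → (b :* x′ :+ (:- a) :* y′) :- (b :* x :+ (:- a) :* y) := b :* (x′ :- x) :- a :* (y′ :- y)) refl x y x′ y′ (dx d) (dy d) ⟩
    dy d * (x′ - x) - dx d * (y′ - y)            ≡⟨ cong₂ (λ u v → dy d * u - dx d * v) u≡ v≡ ⟩
    dy d * (k * dx d) - dx d * (k * dy d)        ≡⟨ solve 3 (λ k a b → b :* (k :* a) :- a :* (k :* b) := con (0 , 0)) refl k (dx d) (dy d) ⟩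
    0#                                           ∎)
    where open ≡-Reasoning

  -- The vector (b , -a) is `k` times the direction of some class `d`, so the left side of the
  -- equation of `L` is -k times the level in that class; hence the constant -c/k.
  ∃-classLine : ∀ L → ∃[ d ] ∃[ c ] (∀ p → On (classLine d c) p → On L p)
  ∃-classLine L with ∃-class (b L) (- a L) (λ (b≡0 , -a≡0) → nondegenerate L (-x≡0⇒x≡0 -a≡0 , b≡0))
  ... | d , k , k≢0 , b≡ , -a≡ with inverse k k≢0
  ...   | k⁻¹ , k*k⁻¹≡1 = d , - (c L * k⁻¹) , λ (x , y) on → begin
    a L * x + b L * y                    ≡⟨ solve 4 (λ a b x y → a :* x :+ b :* y := (:- (:- a)) :* x :+ b :* y) refl (a L) (b L) x y ⟩
    (- (- a L)) * x + b L * y            ≡⟨ cong₂ (λ u v → (- v) * x + u * y) b≡ -a≡ ⟩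
    (- (k * dy d)) * x + k * dx d * y    ≡⟨ solve 5 (λ k a b x y → (:- (k :* b)) :* x :+ k :* a :* y := :- (k :* (b :* x :+ (:- a) :* y))) refl k (dx d) (dy d) x y ⟩
    - (k * level d (x , y))              ≡⟨ cong (λ z → - (k * z)) on ⟩
    - (k * - (c L * k⁻¹))                ≡⟨ solve 3 (λ k c i → :- (k :* (:- (c :* i))) := c :* (k :* i)) refl k (c L) k⁻¹ ⟩
    c L * (k * k⁻¹)                      ≡⟨ cong (c L *_) k*k⁻¹≡1 ⟩
    c L * 1#                             ≡⟨ *-identityʳ _ ⟩
    c L                                  ∎
    where open ≡-Reasoning

  -- Lower bounds

  pencil-weight : ∀ F → 1 ≤ ∣ F ∣ → ∃[ T ] ∣ F ∣ ℕ.+ q ≤ weight F T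
  pencil-weight F@record { points = p ∷ ps } _ = T , ℕ.s≤s⁻¹ (begin
    suc (∣ F ∣ ℕ.+ q)  ≡⟨ ℕ.+-suc ∣ F ∣ q ⟨
    ∣ F ∣ ℕ.+ suc q    ≤⟨ ∑-count-pencil (On? ∘ line T) (joining p) {xs = p ∷ ps} (here refl) (λ _ → refl) ⟩
    suc (weight F T)   ∎)
    where
    open ℕ.≤-Reasoning
    T = classTransversal (λ d → level d p)

  class-pigeonhole : ∀ F {m} → q ℕ.* m < ∣ F ∣ → ∀ d → ∃[ c ] m < ∣ F ∩ classLine d c ∣
  class-pigeonhole F qm<F d
    with i , m< ← ∑-pigeonhole (λ i → ∣ F ∩ classLine d (element i) ∣)
      (ℕ.<-≤-trans qm<F (∑-count-cover (λ i → On? (classLine d (element i)))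
        (λ p → index (level d p) , sym (element-index _)) (points F)))
    = element i , m<

  uniform-weight : ∀ F {m} → q ℕ.* m < ∣ F ∣ → ∃[ T ] suc q ℕ.* suc m ≤ weight F T
  uniform-weight F qm<F =
    classTransversal (proj₁ ∘ class-pigeonhole F qm<F) , ∑-≥ (proj₂ ∘ class-pigeonhole F qm<F)

  -- Lines contained in a large point set.

  param : Fin (suc q) → Carrier → Carrier → Point
  param zero    c t = c , t
  param (suc i) c t = t , element i * t - c

  param-on : ∀ d c t → On (classLine d c) (param d c t)
  param-on zero    c t = solve 2 (λ c t → con (1 , 0) :* c :+ (:- con (0 , 0)) :* t := c) refl c t
  param-on (suc i) c t = solve 3 (λ m c t → m :* t :+ (:- con (1 , 0)) :* (m :* t :- c) := c) refl (element i) c t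

  param-injective : ∀ d c {t t′} → param d c t ≡ param d c t′ → t ≡ t′
  param-injective zero    c refl = refl
  param-injective (suc i) c eq   = cong proj₁ eq

  -- Contrapositive of `blocking-size`. The witness comes from a search through the finitely many
  -- class lines.
  unblocked-line : ∀ B → length B ≤ 2 ℕ.* (q ℕ.∸ 1) → ∃[ d ] ∃[ c ] ¬ Any (On (classLine d c)) B
  unblocked-line B small = search (Fin.any? λ d → Fin.any? λ i → ¬? (meets? d (element i)))
    where
    meets? : ∀ d c → Dec (Any (On (classLine d c)) B)
    meets? d c = Any.any? (On? (classLine d c)) B
    search : Dec (∃[ d ] ∃[ i ] ¬ Any (On (classLine d (element i))) B) → ∃[ d ] ∃[ c ] ¬ Any (On (classLine d c)) B
    search (yes (d , i , free)) = d , element i , free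
    search (no  blocked)        = contradiction small (ℕ.<⇒≱ (blocking-size blocking))
      where
      blocking : Blocking B
      blocking L =
        let (d , c , class⊆L) = ∃-classLine L
            (p , p∈ , on)     = find (decidable-stable (meets? d (element (index c))) λ none → blocked (d , index c , none))
        in p , p∈ , class⊆L p (trans on (element-index c))

  open DecMembership (≡-dec _≟_ _≟_) using (_∈?_)

  allPoints : List Point
  allPoints = cartesianProduct elements elements

  ∈-allPoints : ∀ p → p ∈ allPoints
  ∈-allPoints (x , y) = ∈-cartesianProduct⁺ (∈-elements x) (∈-elements y)

  length-cartesianProduct : ∀ {A B : Set} (xs : List A) (ys : List B) → length (cartesianProduct xs ys) ≡ length xs ℕ.* length ys
  length-cartesianProduct []       ys = refl
  length-cartesianProduct (x ∷ xs) ys = trans (List.length-++ (map (x ,_) ys))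
    (cong₂ ℕ._+_ (List.length-map (x ,_) ys) (length-cartesianProduct xs ys))

  module _ (F : PointSet) where

    complement : List Point
    complement = filter (λ p → ¬? (p ∈? points F)) allPoints

    length-complement : ∣ F ∣ ℕ.+ length complement ≤ q ℕ.* q
    length-complement = begin
      ∣ F ∣ ℕ.+ length complement           ≡⟨ List.length-++ (points F) ⟨
      length (points F ++ complement)       ≤⟨ unique-⊆⇒length≤ disjoint-union (λ {p} _ → ∈-allPoints p) ⟩
      length allPoints                      ≡⟨ length-cartesianProduct elements elements ⟩
      length elements ℕ.* length elements   ≡⟨ cong₂ ℕ._*_ length-elements length-elements ⟩
      q ℕ.* q                               ∎
      where
      open ℕ.≤-Reasoning
      disjoint-union : Unique (points F ++ complement)
      disjoint-union = Unique.++⁺ (unique F)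
        (Unique.filter⁺ (λ p → ¬? (p ∈? points F)) (Unique.cartesianProduct⁺ elements-unique elements-unique))
        λ (p∈F , p∈c) → proj₂ (∈-filter⁻ (λ p → ¬? (p ∈? points F)) {xs = allPoints} p∈c) p∈F

    -- The complement of `F` is too small to be a blocking set, and a line that misses it lies in
    -- `F`.
    full-line : q ℕ.* q ≤ ∣ F ∣ ℕ.+ 2 ℕ.* (q ℕ.∸ 1) → ∃[ d ] ∃[ c ] q ≤ ∣ F ∩ classLine d c ∣
    full-line large = let (d , c , free) = unblocked in d , c , full d c free
      where
      unblocked : ∃[ d ] ∃[ c ] ¬ Any (On (classLine d c)) complement
      unblocked = unblocked-line complement (ℕ.+-cancelˡ-≤ ∣ F ∣ (length complement) (2 ℕ.* (q ℕ.∸ 1)) (ℕ.≤-trans length-complement large))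
      full : ∀ d c → ¬ Any (On (classLine d c)) complement → q ≤ ∣ F ∩ classLine d c ∣
      full d c free = subst (_≤ ∣ F ∩ classLine d c ∣) length-elements
        (length≤-injection (param d c) {ys = filter (On? (classLine d c)) (points F)} elements-unique (λ _ _ → param-injective d c) (λ {t} _ → on-F t))
        where
        on-F : ∀ t → param d c t ∈ filter (On? (classLine d c)) (points F)
        on-F t = ∈-filter⁺ (On? (classLine d c)) {xs = points F}
          (decidable-stable (param d c t ∈? points F) λ p∉F →
            free (lose (∈-filter⁺ (λ p → ¬? (p ∈? points F)) (∈-allPoints (param d c t)) p∉F) (param-on d c t)))
          (param-on d c t)

    -- The class of the full line contributes q, each of the other q classes at least m + 1.
    full-weight : ∀ {m} → m < q → q ℕ.* q ≤ ∣ F ∣ ℕ.+ 2 ℕ.* (q ℕ.∸ 1) → q ℕ.* m < ∣ F ∣ → ∃[ T ] q ℕ.+ q ℕ.* suc m ≤ weight F T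
    full-weight {m} m<q large qm<F with full-line large
    ... | d , c , q≤ = classTransversal γ , ∑-≥-exception d (subst (λ c → q ≤ ∣ F ∩ classLine d c ∣) (sym γd≡c) q≤) γ-heavy
      where
      -- In class `d` the full line replaces the one found by pigeonhole; the last component records
      -- this, so that `γ d` can be identified with `c`.
      choose : ∀ e → ∃[ c′ ] m < ∣ F ∩ classLine e c′ ∣ × (e ≡ d → c′ ≡ c)
      choose e with e Fin.≟ d | class-pigeonhole F qm<F e
      ... | no  e≢d  | c′ , m< = c′ , m< , λ e≡d → contradiction e≡d e≢d
      ... | yes refl | c′ , m< = c , ℕ.<-≤-trans m<q q≤ , λ _ → refl
      γ : Fin (suc q) → Carrier
      γ = proj₁ ∘ choose
      γd≡c : γ d ≡ c
      γd≡c = proj₂ (proj₂ (choose d)) refl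
      γ-heavy : ∀ e → m < ∣ F ∩ classLine e (γ e) ∣
      γ-heavy e = proj₁ (proj₂ (choose e))

-- Grids and their intersections with lines and transversals.

module Upper {q : ℕ} (K : FiniteField q) where
  open FiniteField K
  open FieldProperties K
  open AG K
  open Line
  open Plane K

  -- Upper bounds

  same-x : ∀ L {x y y′} → b L ≢ 0# → On L (x , y) → On L (x , y′) → y ≡ y′
  same-x L {x} {y} {y′} b≢0 on on′ = *-cancelˡ-≢0 b≢0 (begin
    b L * y                          ≡⟨ solve 2 (λ u v → v := (u :+ v) :- u) refl (a L * x) (b L * y) ⟩
    (a L * x + b L * y) - a L * x    ≡⟨ cong (_- a L * x) (trans on (sym on′)) ⟩
    (a L * x + b L * y′) - a L * x   ≡⟨ solve 2 (λ u v → (u :+ v) :- u := v) refl (a L * x) (b L * y′) ⟩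
    b L * y′                         ∎)
    where open ≡-Reasoning

  same-y : ∀ L {x x′ y} → a L ≢ 0# → On L (x , y) → On L (x′ , y) → x ≡ x′
  same-y L {x} {x′} {y} a≢0 on on′ = *-cancelˡ-≢0 a≢0 (begin
    a L * x                          ≡⟨ solve 2 (λ u v → u := (u :+ v) :- v) refl (a L * x) (b L * y) ⟩
    (a L * x + b L * y) - b L * y    ≡⟨ cong (_- b L * y) (trans on (sym on′)) ⟩
    (a L * x′ + b L * y) - b L * y   ≡⟨ solve 2 (λ u v → (u :+ v) :- v := u) refl (a L * x′) (b L * y) ⟩
    a L * x′                         ∎)
    where open ≡-Reasoning

  module _ (F : PointSet) where

    private
      on-both : ∀ L {p} → p ∈ filter (On? L) (points F) → p ∈ points F × On L p
      on-both L = ∈-filter⁻ (On? L) {xs = points F}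

    -- A line with `b` nonzero meets each column at most once.
    columns-bound : ∀ {xs} → (∀ {p} → p ∈ points F → proj₁ p ∈ xs) → ∀ L → b L ≢ 0# → ∣ F ∩ L ∣ ≤ length xs
    columns-bound F⊆ L b≢0 = length≤-injection proj₁ (Unique.filter⁺ (On? L) (unique F))
      (λ p∈ p′∈ → λ { refl → cong (_ ,_) (same-x L b≢0 (proj₂ (on-both L p∈)) (proj₂ (on-both L p′∈))) })
      (λ p∈ → F⊆ (proj₁ (on-both L p∈)))

    rows-bound : ∀ {ys} → (∀ {p} → p ∈ points F → proj₂ p ∈ ys) → ∀ L → a L ≢ 0# → ∣ F ∩ L ∣ ≤ length ys
    rows-bound F⊆ L a≢0 = length≤-injection proj₂ (Unique.filter⁺ (On? L) (unique F))
      (λ p∈ p′∈ → λ { refl → cong (_, _) (same-y L a≢0 (proj₂ (on-both L p∈)) (proj₂ (on-both L p′∈))) })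
      (λ p∈ → F⊆ (proj₁ (on-both L p∈)))

    grid-bound : ∀ {xs ys m} → length xs ≤ m → length ys ≤ m →
      (∀ {p} → p ∈ points F → proj₁ p ∈ xs) → (∀ {p} → p ∈ points F → proj₂ p ∈ ys) → ∀ L → ∣ F ∩ L ∣ ≤ m
    grid-bound xs≤m ys≤m F⊆xs F⊆ys L = by-cases (a L ≟ 0#)
      where
      by-cases : Dec (a L ≡ 0#) → ∣ F ∩ L ∣ ≤ _
      by-cases (no  a≢0) = ℕ.≤-trans (rows-bound F⊆ys L a≢0) ys≤m
      by-cases (yes a≡0) = ℕ.≤-trans (columns-bound F⊆xs L λ b≡0 → nondegenerate L (a≡0 , b≡0)) xs≤m

    ∣F∩L∣≤q : ∀ L → ∣ F ∩ L ∣ ≤ q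
    ∣F∩L∣≤q = grid-bound (ℕ.≤-reflexive length-elements) (ℕ.≤-reflexive length-elements)
      (λ {p} _ → ∈-elements (proj₁ p)) (λ {p} _ → ∈-elements (proj₂ p))

    ∣F∩L∣≤∣F∣ : ∀ L → ∣ F ∩ L ∣ ≤ ∣ F ∣
    ∣F∩L∣≤∣F∣ L = List.length-filter (On? L) (points F)

  horizontal : ∀ L → a L ≡ 0# → ∃[ h ] (∀ x y → On L (x , y) → y ≡ h) × (∀ x → On L (x , h))
  horizontal L a≡0 =
    let (b⁻¹ , b*b⁻¹≡1) = inverse (b L) (λ b≡0 → nondegenerate L (a≡0 , b≡0))
        on : ∀ x → On L (x , c L * b⁻¹)
        on x = begin
          a L * x + b L * (c L * b⁻¹)  ≡⟨ cong (λ z → z * x + b L * (c L * b⁻¹)) a≡0 ⟩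
          0# * x + b L * (c L * b⁻¹)   ≡⟨ solve 4 (λ x b c i → con (0 , 0) :* x :+ b :* (c :* i) := c :* (b :* i)) refl x (b L) (c L) b⁻¹ ⟩
          c L * (b L * b⁻¹)            ≡⟨ cong (c L *_) b*b⁻¹≡1 ⟩
          c L * 1#                     ≡⟨ *-identityʳ (c L) ⟩
          c L                          ∎
    in c L * b⁻¹ , (λ x y on′ → same-x L (λ b≡0 → nondegenerate L (a≡0 , b≡0)) on′ (on x)) , on
    where open ≡-Reasoning

  horizontals-parallel : ∀ L M → a L ≡ 0# → a M ≡ 0# → L ∥ M
  horizontals-parallel L M aL≡0 aM≡0 = parallel (horizontal L aL≡0) (horizontal M aM≡0)
    where
    parallel : ∃[ h ] (∀ x y → On L (x , y) → y ≡ h) × (∀ x → On L (x , h)) →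
               ∃[ h ] (∀ x y → On M (x , y) → y ≡ h) × (∀ x → On M (x , h)) → L ∥ M
    parallel (h , L-only , L-on) (k , M-only , M-on) with h ≟ k
    ... | no  h≢k  = inj₂ λ {(x , y)} (onL , onM) → h≢k (trans (sym (L-only x y onL)) (M-only x y onM))
    ... | yes refl = inj₁ ( (λ {(x , y)} onL → subst (λ z → On M (x , z)) (sym (L-only x y onL)) (M-on x))
                          , (λ {(x , y)} onM → subst (λ z → On L (x , z)) (sym (M-only x y onM)) (L-on x)))

  -- A transversal has at most one horizontal line, and each of its other lines meets every row at
  -- most once.
  rows-weight : ∀ F {ys m} → (∀ {p} → p ∈ points F → proj₂ p ∈ ys) → length ys ≤ m → (∀ L → ∣ F ∩ L ∣ ≤ m) →
    ∀ T → weight F T ≤ m ℕ.+ q ℕ.* length ys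
  rows-weight F F⊆ ys≤m F∩≤m T = ∑-≤-exception (λ i → a (line T i) ≟ 0#) ys≤m
    (λ {i} {j} ai≡0 aj≡0 → decidable-stable (i Fin.≟ j) λ i≢j →
      nonparallel T i j i≢j (horizontals-parallel (line T i) (line T j) ai≡0 aj≡0))
    (λ i → F∩≤m (line T i)) (λ i → rows-bound F F⊆ (line T i))

  -- Here `r` counts columns and `s` counts rows. Truncation to `u` points lets one construction
  -- serve all extremal sets except those from the conic.
  module Grid {r s u} (r≤q : r ≤ q) (s≤q : s ≤ q) (u≤r*s : u ≤ r ℕ.* s) where

    xs ys : List Carrier
    xs = take r elements
    ys = take s elements

    length-prefix : ∀ {k} → k ≤ q → length (take k elements) ≡ k
    length-prefix k≤q = length-take-≤ (subst (_ ≤_) (sym length-elements) k≤q)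

    grid : PointSet
    grid = record
      { points = take u (cartesianProduct xs ys)
      ; unique = Unique.take⁺ u (Unique.cartesianProduct⁺ (Unique.take⁺ r elements-unique) (Unique.take⁺ s elements-unique))
      }

    ∣grid∣ : ∣ grid ∣ ≡ u
    ∣grid∣ = length-take-≤ (subst (u ≤_) (sym (trans (length-cartesianProduct xs ys)
      (cong₂ ℕ._*_ (length-prefix r≤q) (length-prefix s≤q)))) u≤r*s)

    grid-x : ∀ {p} → p ∈ points grid → proj₁ p ∈ xs
    grid-x p∈ = proj₁ (∈-cartesianProduct⁻ xs ys (take-⊆ u (cartesianProduct xs ys) p∈))

    grid-y : ∀ {p} → p ∈ points grid → proj₂ p ∈ ys
    grid-y p∈ = proj₂ (∈-cartesianProduct⁻ xs ys (take-⊆ u (cartesianProduct xs ys) p∈))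

    grid-weight : ∀ {m} → s ≤ m → (∀ L → ∣ grid ∩ L ∣ ≤ m) → ∀ T → weight grid T ≤ m ℕ.+ q ℕ.* s
    grid-weight {m} s≤m grid≤m T = subst (λ k → weight grid T ≤ m ℕ.+ q ℕ.* k) (length-prefix s≤q)
      (rows-weight grid grid-y (subst (_≤ m) (sym (length-prefix s≤q)) s≤m) grid≤m T)

    grid-line : ∀ {m} → r ≤ m → s ≤ m → ∀ L → ∣ grid ∩ L ∣ ≤ m
    grid-line {m} r≤m s≤m = grid-bound grid (subst (_≤ m) (sym (length-prefix r≤q)) r≤m)
      (subst (_≤ m) (sym (length-prefix s≤q)) s≤m) grid-x grid-y

  uniform-bound : ∀ F {m} → (∀ L → ∣ F ∩ L ∣ ≤ m) → ∀ T → weight F T ≤ suc q ℕ.* m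
  uniform-bound F F∩≤m T = ∑-≤ (λ i → F∩≤m (line T i))

-- An anisotropic conic and its nucleus.

module Conic {q : ℕ} (K : FiniteField q) where
  open FiniteField K
  open FieldProperties K
  open AG K
  open Line
  open Plane K
  open Upper K
  open ≡-Reasoning

  κ : Carrier
  κ = proj₁ ∃-irreducible

  -- The norm form of the quadratic extension defined by X² − X − κ.
  N : Carrier → Carrier → Carrier
  N x y = x * x - x * y - κ * (y * y)

  -- For y nonzero, a zero of the form would make x/y a solution of X² - X = κ; for y = 0 the form
  -- is x².
  N≢0 : ∀ {x y} → ¬ (x ≡ 0# × y ≡ 0#) → N x y ≢ 0#
  N≢0 {x} {y} xy≢0 N≡0 = by-cases (y ≟ 0#)
    where
    by-cases : ¬ Dec (y ≡ 0#)
    by-cases (yes refl) = xy≢0 (decidable-stable (x ≟ 0#) (λ x≢0 → x≢0 (*-zero-cancelˡ x≢0 (trans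
      (solve 2 (λ x k → x :* x := x :* x :- x :* con (0 , 0) :- k :* (con (0 , 0) :* con (0 , 0))) refl x κ) N≡0))) , refl)
    by-cases (no y≢0) = proj₂ ∃-irreducible (x * z) (begin
      x * z * (x * z) - x * z                                      ≡⟨ solve 4 (λ x y z k → x :* z :* (x :* z) :- x :* z :=
        z :* z :* (x :* x :- x :* y :- k :* (y :* y)) :+ (x :* z :* (y :* z) :- x :* z) :+ k :* (y :* z :* (y :* z))) refl x y z κ ⟩
      z * z * N x y + (x * z * (y * z) - x * z) + κ * (y * z * (y * z))  ≡⟨ cong₂ (λ n w → z * z * n + (x * z * w - x * z) + κ * (w * w)) N≡0 yz≡1 ⟩
      z * z * 0# + (x * z * 1# - x * z) + κ * (1# * 1#)            ≡⟨ solve 3 (λ x z k →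
        z :* z :* con (0 , 0) :+ (x :* z :* con (1 , 0) :- x :* z) :+ k :* (con (1 , 0) :* con (1 , 0)) := k) refl x z κ ⟩
      κ                                                            ∎)
      where
      z = proj₁ (inverse y y≢0)
      yz≡1 = proj₂ (inverse y y≢0)

  -- The polar form of `N`: the value of `N` at the sum of two vectors minus its values at both.
  polar : Carrier → Carrier → Carrier → Carrier → Carrier
  polar x y u v = (x * u + x * u) - x * v - y * u - κ * (y * v + y * v)

  N-line : ∀ x y t u v → N (x + t * u) (y + t * v) ≡ N x y + t * (polar x y u v + t * N u v)
  N-line x y t u v = solve 6 (λ x y t u v k →
    let x′ = x :+ t :* u ; y′ = y :+ t :* v in
    x′ :* x′ :- x′ :* y′ :- k :* (y′ :* y′) :=
    (x :* x :- x :* y :- k :* (y :* y)) :+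
      t :* (((x :* u :+ x :* u) :- x :* v :- y :* u :- k :* (y :* v :+ y :* v)) :+ t :* (u :* u :- u :* v :- k :* (v :* v))))
    refl x y t u v κ

  chord : ∀ L {x y x′ y′} → On L (x , y) → On L (x′ , y′) → ∃[ t ] (x′ , y′) ≡ (x + t * b L , y + t * - a L)
  chord L {x} {y} {x′} {y′} on on′ = by-cases (b L ≟ 0#)
    where
    equation : a L * (x′ - x) + b L * (y′ - y) ≡ 0#
    equation = trans (solve 6 (λ a b x y x′ y′ → a :* (x′ :- x) :+ b :* (y′ :- y) := (a :* x′ :+ b :* y′) :- (a :* x :+ b :* y)) refl (a L) (b L) x y x′ y′)
      (x≡y⇒x-y≡0 (trans on′ (sym on)))
    along : ∀ t → x′ - x ≡ t * b L → y′ - y ≡ t * - a L → (x′ , y′) ≡ (x + t * b L , y + t * - a L)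
    along t x-eq y-eq = cong₂ _,_ (move x-eq) (move y-eq)
      where
      move : ∀ {z z′ w} → z′ - z ≡ w → z′ ≡ z + w
      move {z} {z′} refl = solve 2 (λ z z′ → z′ := z :+ (z′ :- z)) refl z z′
    divide : ∀ {z} → z ≢ 0# → ∀ w → ∃[ t ] w ≡ t * z
    divide {z} z≢0 w with inverse z z≢0
    ... | z⁻¹ , z*z⁻¹≡1 = w * z⁻¹ , sym (begin
      w * z⁻¹ * z    ≡⟨ solve 3 (λ w i z → w :* i :* z := w :* (z :* i)) refl w z⁻¹ z ⟩
      w * (z * z⁻¹)  ≡⟨ cong (w *_) z*z⁻¹≡1 ⟩
      w * 1#         ≡⟨ *-identityʳ w ⟩
      w              ∎)
    by-cases : Dec (b L ≡ 0#) → ∃[ t ] (x′ , y′) ≡ (x + t * b L , y + t * - a L)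
    by-cases (no b≢0) = let (t , x-eq) = divide b≢0 (x′ - x) in t , along t x-eq (*-cancelˡ-≢0 b≢0 (begin
      b L * (y′ - y)                                          ≡⟨ solve 2 (λ u v → v := (u :+ v) :- u) refl (a L * (x′ - x)) (b L * (y′ - y)) ⟩
      (a L * (x′ - x) + b L * (y′ - y)) - a L * (x′ - x)      ≡⟨ cong₂ (λ z w → z - a L * w) equation x-eq ⟩
      0# - a L * (t * b L)                                    ≡⟨ solve 3 (λ a b t → con (0 , 0) :- a :* (t :* b) := b :* (t :* (:- a))) refl (a L) (b L) t ⟩
      b L * (t * - a L)                                       ∎))
    by-cases (yes b≡0) = let (t , y-eq) = divide -a≢0 (y′ - y) in t , along t (trans x′-x≡0 (sym (trans (cong (t *_) b≡0) (zeroʳ t)))) y-eq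
      where
      a≢0 : a L ≢ 0#
      a≢0 a≡0 = nondegenerate L (a≡0 , b≡0)
      -a≢0 : - a L ≢ 0#
      -a≢0 -a≡0 = a≢0 (-x≡0⇒x≡0 -a≡0)
      x′-x≡0 : x′ - x ≡ 0#
      x′-x≡0 = *-zero-cancelˡ a≢0 (begin
        a L * (x′ - x)                          ≡⟨ solve 2 (λ u w → u := u :+ con (0 , 0) :* w) refl (a L * (x′ - x)) (y′ - y) ⟩
        a L * (x′ - x) + 0# * (y′ - y)          ≡⟨ cong (λ z → a L * (x′ - x) + z * (y′ - y)) b≡0 ⟨
        a L * (x′ - x) + b L * (y′ - y)         ≡⟨ equation ⟩
        0#                                      ∎)

  OnConic : Point → Set
  OnConic (x , y) = N x y ≡ 1#

  N-direction : Line → Carrier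
  N-direction L = N (b L) (- a L)

  N-direction≢0 : ∀ L → N-direction L ≢ 0#
  N-direction≢0 L = N≢0 λ (b≡0 , -a≡0) → nondegenerate L (-x≡0⇒x≡0 -a≡0 , b≡0)

  -- Along `L`, starting from the first point, the conic has the equation t(β + tn) = 0 with n
  -- nonzero; besides t = 0 this leaves at most one parameter.
  secant : ∀ L {p p′ p″} → On L p → On L p′ → On L p″ → OnConic p → OnConic p′ → OnConic p″ →
    p ≢ p′ → p ≢ p″ → p′ ≡ p″
  secant L {x , y} on on′ on″ N≡1 N′≡1 N″≡1 p≢p′ p≢p″ with chord L on on′ | chord L on on″
  ... | t , refl | s , refl = cong (λ t → (x + t * b L , y + t * - a L)) (*-cancelˡ-≢0 (N-direction≢0 L) (begin
      n * t              ≡⟨ solve 3 (λ n t β → n :* t := (β :+ t :* n) :- β) refl n t β ⟩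
      (β + t * n) - β    ≡⟨ cong (_- β) (trans (root t p≢p′ N′≡1) (sym (root s p≢p″ N″≡1))) ⟩
      (β + s * n) - β    ≡⟨ solve 3 (λ n t β → (β :+ t :* n) :- β := n :* t) refl n s β ⟩
      n * s              ∎))
    where
    n = N-direction L
    β = polar x y (b L) (- a L)
    root : ∀ t → (x , y) ≢ (x + t * b L , y + t * - a L) → N (x + t * b L) (y + t * - a L) ≡ 1# → β + t * n ≡ 0#
    root t p≢ N≡1′ = *-zero-cancelˡ t≢0 (begin
      t * (β + t * n)                    ≡⟨ solve 2 (λ u w → w := (u :+ w) :- u) refl (N x y) (t * (β + t * n)) ⟩
      (N x y + t * (β + t * n)) - N x y  ≡⟨ cong (_- N x y) (N-line x y t (b L) (- a L)) ⟨
      N (x + t * b L) (y + t * - a L) - N x y ≡⟨ x≡y⇒x-y≡0 (trans N≡1′ (sym N≡1)) ⟩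
      0#                                 ∎)
      where
      t≢0 : t ≢ 0#
      t≢0 refl = p≢ (cong₂ _,_ (solve 2 (λ x b → x := x :+ con (0 , 0) :* b) refl x (b L)) (solve 2 (λ y a → y := y :+ con (0 , 0) :* (:- a)) refl y (a L)))

  -- In characteristic 2 the origin is the nucleus of the conic.
  nucleus : 1# + 1# ≡ 0# → ∀ L {p p′} → On L (0# , 0#) → On L p → On L p′ → OnConic p → OnConic p′ → p ≡ p′
  nucleus 1+1≡0 L on₀ on on′ N≡1 N′≡1 with chord L on₀ on | chord L on₀ on′
  ... | t , refl | s , refl = cong (λ t → (0# + t * b L , 0# + t * - a L)) (x-y≡0⇒x≡y
      -- The form is homogeneous of degree 2, so t² = s²; in characteristic 2 this says (t - s)² =
      -- 0.
      (decidable-stable ((t - s) ≟ 0#) λ t-s≢0 → t-s≢0 (*-zero-cancelˡ t-s≢0 (begin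
        (t - s) * (t - s)                                 ≡⟨ solve 2 (λ t s → (t :- s) :* (t :- s) := (t :* t :- s :* s) :+ (con (1 , 0) :+ con (1 , 0)) :* (s :* s :- t :* s)) refl t s ⟩
        (t * t - s * s) + (1# + 1#) * (s * s - t * s)     ≡⟨ cong₂ (λ u w → u + w * (s * s - t * s)) (x≡y⇒x-y≡0 t²≡s²) 1+1≡0 ⟩
        0# + 0# * (s * s - t * s)                         ≡⟨ solve 1 (λ u → con (0 , 0) :+ con (0 , 0) :* u := con (0 , 0)) refl (s * s - t * s) ⟩
        0#                                                ∎))))
    where
    n = N-direction L
    homogeneous : ∀ t → N (0# + t * b L) (0# + t * - a L) ≡ n * (t * t)
    homogeneous t = solve 4 (λ t u v k →
      let x = con (0 , 0) :+ t :* u ; y = con (0 , 0) :+ t :* (:- v) in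
      x :* x :- x :* y :- k :* (y :* y) := (u :* u :- u :* (:- v) :- k :* ((:- v) :* (:- v))) :* (t :* t)) refl t (b L) (a L) κ
    t²≡s² : t * t ≡ s * s
    t²≡s² = *-cancelˡ-≢0 (N-direction≢0 L) (trans (sym (homogeneous t)) (trans N≡1 (trans (sym N′≡1) (homogeneous s))))

  N-dir≢0 : ∀ d → N (dx d) (dy d) ≢ 0#
  N-dir≢0 d = N≢0 (direction≢0 d)

  N⁻¹ : Fin (suc q) → Carrier
  N⁻¹ d = proj₁ (inverse (N (dx d) (dy d)) (N-dir≢0 d))

  -- The negative of the polar form of (1 , 0) and the direction. It vanishes exactly if the line
  -- through (1 , 0) in this direction is tangent, and its quotient by `N` of the direction is the
  -- parameter of the second intersection.
  tangency : Fin (suc q) → Carrier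
  tangency d = dy d - (dx d + dx d)

  τ : Fin (suc q) → Carrier
  τ d = tangency d * N⁻¹ d

  τ*N : ∀ d → τ d * N (dx d) (dy d) ≡ tangency d
  τ*N d = begin
    tangency d * N⁻¹ d * n    ≡⟨ solve 3 (λ k i n → k :* i :* n := k :* (n :* i)) refl (tangency d) (N⁻¹ d) n ⟩
    tangency d * (n * N⁻¹ d)  ≡⟨ cong (tangency d *_) (proj₂ (inverse n (N-dir≢0 d))) ⟩
    tangency d * 1#           ≡⟨ *-identityʳ _ ⟩
    tangency d                ∎
    where
    n = N (dx d) (dy d)

  -- The second intersection of the conic with the line through (1 , 0) in direction d.
  conicPoint : Fin (suc q) → Point
  conicPoint d = 1# + τ d * dx d , 0# + τ d * dy d

  conicPoint-on : ∀ d → OnConic (conicPoint d)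
  conicPoint-on d = begin
    N (1# + τ d * dx d) (0# + τ d * dy d)                                     ≡⟨ N-line 1# 0# (τ d) (dx d) (dy d) ⟩
    N 1# 0# + τ d * (polar 1# 0# (dx d) (dy d) + τ d * N (dx d) (dy d))       ≡⟨ cong (λ z → N 1# 0# + τ d * (polar 1# 0# (dx d) (dy d) + z)) (τ*N d) ⟩
    N 1# 0# + τ d * (polar 1# 0# (dx d) (dy d) + tangency d)                  ≡⟨ solve 4 (λ t u v k →
      let o = con (1 , 0) ; z = con (0 , 0) in
      (o :* o :- o :* z :- k :* (z :* z)) :+ t :* (((o :* u :+ o :* u) :- o :* v :- z :* u :- k :* (z :* v :+ z :* v)) :+ (v :- (u :+ u))) := o)
      refl (τ d) (dx d) (dy d) κ ⟩
    1#                                                                        ∎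

  -- A point common to the lines of two directions through (1 , 0) is (1 , 0) itself, so both lines
  -- are tangent. Then both directions satisfy dy = 2 dx and are proportional.
  conicPoint-injective : ∀ {d e} → conicPoint d ≡ conicPoint e → d ≡ e
  conicPoint-injective {d} {e} eq = decidable-stable (d Fin.≟ e) λ d≢e → det≢0 d≢e (begin
    dx d * dy e - dx e * dy d                  ≡⟨ solve 4 (λ a b a′ b′ → a :* b′ :- a′ :* b := a :* (b′ :- (a′ :+ a′)) :- a′ :* (b :- (a :+ a))) refl (dx d) (dy d) (dx e) (dy e) ⟩
    dx d * tangency e - dx e * tangency d      ≡⟨ cong₂ (λ u v → dx d * u - dx e * v) (tangent (d≢e ∘ sym) (sym eq)) (tangent d≢e eq) ⟩
    dx d * 0# - dx e * 0#                      ≡⟨ solve 2 (λ a a′ → a :* con (0 , 0) :- a′ :* con (0 , 0) := con (0 , 0)) refl (dx d) (dx e) ⟩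
    0#                                         ∎)
    where
    tangent : ∀ {d e} → d ≢ e → conicPoint d ≡ conicPoint e → tangency d ≡ 0#
    tangent {d} {e} d≢e eq = begin
      tangency d                ≡⟨ τ*N d ⟨
      τ d * N (dx d) (dy d)     ≡⟨ cong (_* N (dx d) (dy d)) (*-zero-cancelʳ (det≢0 d≢e) τ*det≡0) ⟩
      0# * N (dx d) (dy d)      ≡⟨ zeroˡ _ ⟩
      0#                        ∎
      where
      τ*det≡0 : τ d * det d e ≡ 0#
      τ*det≡0 = begin
        τ d * det d e                                                           ≡⟨ solve 5 (λ t a b a′ b′ →
          t :* (a :* b′ :- a′ :* b) := ((con (1 , 0) :+ t :* a) :- con (1 , 0)) :* b′ :- a′ :* (con (0 , 0) :+ t :* b)) refl (τ d) (dx d) (dy d) (dx e) (dy e) ⟩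
        ((1# + τ d * dx d) - 1#) * dy e - dx e * (0# + τ d * dy d)              ≡⟨ cong (λ (x , y) → (x - 1#) * dy e - dx e * y) eq ⟩
        ((1# + τ e * dx e) - 1#) * dy e - dx e * (0# + τ e * dy e)              ≡⟨ solve 3 (λ t a b →
          ((con (1 , 0) :+ t :* a) :- con (1 , 0)) :* b :- a :* (con (0 , 0) :+ t :* b) := con (0 , 0)) refl (τ e) (dx e) (dy e) ⟩
        0#                                                                      ∎

  oval : PointSet
  oval = record { points = tabulate conicPoint ; unique = Unique.tabulate⁺ conicPoint-injective }

  ∣oval∣ : ∣ oval ∣ ≡ suc q
  ∣oval∣ = List.length-tabulate conicPoint

  oval-on : ∀ {p} → p ∈ points oval → OnConic p
  oval-on p∈ with ∈-tabulate⁻ {f = conicPoint} p∈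
  ... | d , refl = conicPoint-on d

  oval∩-on : ∀ L {p} → p ∈ filter (On? L) (points oval) → OnConic p × On L p
  oval∩-on L p∈ = let (p∈oval , on) = ∈-filter⁻ (On? L) {xs = points oval} p∈ in oval-on p∈oval , on

  oval-line : ∀ L → ∣ oval ∩ L ∣ ≤ 2
  oval-line L = at-most-two (Unique.filter⁺ (On? L) (unique oval)) λ p∈ p′∈ p″∈ →
    let (N≡1 , on) = oval∩-on L p∈ ; (N′≡1 , on′) = oval∩-on L p′∈ ; (N″≡1 , on″) = oval∩-on L p″∈
    in secant L on on′ on″ N≡1 N′≡1 N″≡1

  hyperoval : PointSet
  hyperoval = record
    { points = (0# , 0#) ∷ points oval
    ; unique = All.tabulate (λ p∈ → λ { refl → 0≢1 (trans (sym N00≡0) (oval-on p∈)) }) ∷ unique oval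
    }
    where
    N00≡0 : N 0# 0# ≡ 0#
    N00≡0 = solve 1 (λ k → let z = con (0 , 0) in z :* z :- z :* z :- k :* (z :* z) := z) refl κ

  ∣hyperoval∣ : ∣ hyperoval ∣ ≡ 2 ℕ.+ q
  ∣hyperoval∣ = cong suc ∣oval∣

  -- A line through the nucleus holds at most one point of the conic; on any other line nothing is
  -- added to the oval.
  hyperoval-line : 1# + 1# ≡ 0# → ∀ L → ∣ hyperoval ∩ L ∣ ≤ 2
  hyperoval-line 1+1≡0 L = by-cases (On? L (0# , 0#))
    where
    by-cases : Dec (On L (0# , 0#)) → ∣ hyperoval ∩ L ∣ ≤ 2
    by-cases (no  off₀) = subst (λ ps → length ps ≤ 2) (sym (List.filter-reject (On? L) off₀)) (oval-line L)
    by-cases (yes on₀)  = subst (λ ps → length ps ≤ 2) (sym (List.filter-accept (On? L) on₀))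
      (s≤s (at-most-one (Unique.filter⁺ (On? L) (unique oval)) λ p∈ p′∈ →
        let (N≡1 , on) = oval∩-on L p∈ ; (N′≡1 , on′) = oval∩-on L p′∈
        in nucleus 1+1≡0 L on₀ on on′ N≡1 N′≡1))

-- Truncated subtractions evaluated for q = k + 2.

q²∸2q : ∀ k → (2 ℕ.+ k) ℕ.^ 2 ℕ.∸ 2 ℕ.* (2 ℕ.+ k) ≡ (2 ℕ.+ k) ℕ.* k
q²∸2q k = trans (cong (ℕ._∸ 2 ℕ.* (2 ℕ.+ k)) (ℕ-solve 1 (λ k → (con 2 :+ k) :^ 2 := con 2 :* (con 2 :+ k) :+ (con 2 :+ k) :* k) refl k))
  (ℕ.m+n∸m≡n (2 ℕ.* (2 ℕ.+ k)) _)
  where open NatSolver.+-*-Solver using (con; _:=_; _:+_; _:*_; _:^_) renaming (solve to ℕ-solve)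

q²∸q : ∀ k → (2 ℕ.+ k) ℕ.^ 2 ℕ.∸ (2 ℕ.+ k) ≡ (2 ℕ.+ k) ℕ.* suc k
q²∸q k = trans (cong (ℕ._∸ (2 ℕ.+ k)) (ℕ-solve 1 (λ k → (con 2 :+ k) :^ 2 := (con 2 :+ k) :+ (con 2 :+ k) :* (con 1 :+ k)) refl k))
  (ℕ.m+n∸m≡n (2 ℕ.+ k) _)
  where open NatSolver.+-*-Solver using (con; _:=_; _:+_; _:*_; _:^_) renaming (solve to ℕ-solve)

q²∸1 : ∀ k → (2 ℕ.+ k) ℕ.^ 2 ℕ.∸ 1 ≡ (3 ℕ.+ k) ℕ.* suc k
q²∸1 k = trans (cong (ℕ._∸ 1) (ℕ-solve 1 (λ k → (con 2 :+ k) :^ 2 := con 1 :+ (con 3 :+ k) :* (con 1 :+ k)) refl k))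
  (ℕ.m+n∸m≡n 1 _)
  where open NatSolver.+-*-Solver using (con; _:=_; _:+_; _:*_; _:^_) renaming (solve to ℕ-solve)

-- Values for collinear sets, unions of parallel lines, and ovals.

module Values {q : ℕ} (K : FiniteField q) where
  open FieldProperties K
  open AG K
  open Plane K
  open Upper K
  open Conic K

  pencil-lower : ∀ {u n} → 1 ≤ u → ∀ F → IsArc u n F → ∃[ T ] u ℕ.+ q ≤ weight F T
  pencil-lower 1≤u F (refl , _) = pencil-weight F 1≤u

  uniform-lower : ∀ {u n m} → q ℕ.* m < u → ∀ F → IsArc u n F → ∃[ T ] suc q ℕ.* suc m ≤ weight F T
  uniform-lower qm<u F (refl , _) = uniform-weight F qm<u

  collinear-value : ∀ n u → 1 ≤ u → u ≤ n ℕ.⊓ q → ℓ⟨ u ∶ n ⟩≡ u ℕ.+ q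
  collinear-value n u 1≤u u≤n⊓q = ℓ-intro (pencil-lower 1≤u)
    (grid , (∣grid∣ , λ L → ℕ.≤-trans (grid≤u L) (ℕ.m≤n⊓o⇒m≤n n q u≤n⊓q))
          , λ T → subst (λ v → weight grid T ≤ u ℕ.+ v) (ℕ.*-identityʳ q) (grid-weight 1≤u grid≤u T))
    where
    -- The extremal set consists of `u` points of a single row.
    open Grid {q} {1} {u} ℕ.≤-refl (ℕ.<⇒≤ 1<q) (subst (u ≤_) (sym (ℕ.*-identityʳ q)) (ℕ.m≤n⊓o⇒m≤o n q u≤n⊓q))
    grid≤u : ∀ L → ∣ grid ∩ L ∣ ≤ u
    grid≤u L = subst (∣ grid ∩ L ∣ ≤_) ∣grid∣ (∣F∩L∣≤∣F∣ grid L)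

  parallel-lines-value : ∀ s → 1 ≤ s → s ≤ q → ℓ⟨ s ℕ.* q ⟩≡ s ℕ.* q ℕ.+ q
  parallel-lines-value s 1≤s s≤q = ℓ-intro (pencil-lower (ℕ.*-mono-≤ 1≤s (ℕ.<⇒≤ 1<q)))
    (grid , (∣grid∣ , ∣F∩L∣≤q grid) , λ T → ℕ.≤-trans (grid-weight s≤q (∣F∩L∣≤q grid) T)
      (ℕ.≤-reflexive (trans (ℕ.+-comm q _) (cong (ℕ._+ q) (ℕ.*-comm q s)))))
    where
    -- The extremal set is the union of `s` full rows.
    open Grid {q} {s} {s ℕ.* q} ℕ.≤-refl s≤q (ℕ.≤-reflexive (ℕ.*-comm s q))

  two-per-class : suc q ℕ.* 2 ≡ 2 ℕ.* (q ℕ.+ 1)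
  two-per-class = trans (ℕ.*-comm (suc q) 2) (cong (2 ℕ.*_) (ℕ.+-comm 1 q))

  -- More than q points force two on some line of every class, and `F` never has more than two.
  two-arc-value : ∀ {u n} → q < u → 2 ≤ n → ∀ F → ∣ F ∣ ≡ u → (∀ L → ∣ F ∩ L ∣ ≤ 2) → ℓ⟨ u ∶ n ⟩≡ 2 ℕ.* (q ℕ.+ 1)
  two-arc-value {u} {n} q<u 2≤n F ∣F∣≡u F∩≤2 = subst (ℓ⟨ u ∶ n ⟩≡_) two-per-class (ℓ-intro
    (uniform-lower (subst (_< u) (sym (ℕ.*-identityʳ q)) q<u))
    (F , (∣F∣≡u , λ L → ℕ.≤-trans (F∩≤2 L) 2≤n) , uniform-bound F F∩≤2))

  oval-value : ∀ n → 2 ≤ n → ℓ⟨ q ℕ.+ 1 ∶ n ⟩≡ 2 ℕ.* (q ℕ.+ 1)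
  oval-value n 2≤n = two-arc-value (ℕ.m<m+n q (s≤s z≤n)) 2≤n oval (trans ∣oval∣ (ℕ.+-comm 1 q)) oval-line

  hyperoval-value : IsPrimePower q → 2 ∣ q → ∀ n → 2 ≤ n → ℓ⟨ q ℕ.+ 2 ∶ n ⟩≡ 2 ℕ.* (q ℕ.+ 1)
  hyperoval-value q-pp 2∣q n 2≤n = two-arc-value (ℕ.m<m+n q (s≤s z≤n)) 2≤n hyperoval
    (trans ∣hyperoval∣ (ℕ.+-comm 2 q)) (hyperoval-line (even⇒1+1≡0 q-pp 2∣q))

-- Values for sets whose complement is small.

module LargeValues {k : ℕ} (K : FiniteField (2 ℕ.+ k)) where
  open AG K
  open Plane K
  open Upper K
  open Values K

  private
    q = 2 ℕ.+ k

  two-lines-value : ℓ⟨ q ℕ.^ 2 ℕ.∸ 2 ℕ.* q ℕ.+ 1 ⟩≡ q ℕ.^ 2 ℕ.∸ 1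
  two-lines-value rewrite q²∸2q k | q²∸1 k = ℓ-intro
    (uniform-lower (ℕ.m<m+n (q ℕ.* k) (s≤s z≤n)))
    (grid , (∣grid∣ , ∣F∩L∣≤q grid) , uniform-bound grid (grid-line ℕ.≤-refl ℕ.≤-refl))
    where
    open NatSolver.+-*-Solver using (con; _:=_; _:+_; _:*_) renaming (solve to ℕ-solve)
    -- The complement of one row and one column: (q - 1)² = q(q - 2) + 1 points, at most q - 1 on a
    -- line.
    open Grid {suc k} {suc k} {q ℕ.* k ℕ.+ 1} (ℕ.n≤1+n _) (ℕ.n≤1+n _)
      (ℕ.≤-reflexive (ℕ-solve 1 (λ k → (con 2 :+ k) :* k :+ con 1 := (con 1 :+ k) :* (con 1 :+ k)) refl k))

  -- At most 2q - 2 points are missing, which forces a full line, and u > q(q - 2) puts q - 1 points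
  -- on a line of every class. Equality holds for sets inside q - 1 rows.
  one-line-value : ∀ u → q ℕ.^ 2 ℕ.∸ 2 ℕ.* q ℕ.+ 2 ≤ u → u ≤ q ℕ.^ 2 ℕ.∸ q → ℓ⟨ u ⟩≡ q ℕ.^ 2
  one-line-value u lower upper rewrite q²∸2q k | q²∸q k = subst (ℓ⟨ u ⟩≡_) q+q[q-1]≡q² (ℓ-intro
    (λ { F (refl , _) → full-weight F (ℕ.m≤n⇒m≤1+n ℕ.≤-refl) large (ℕ.<-≤-trans (ℕ.m<m+n (q ℕ.* k) (s≤s z≤n)) lower) })
    (grid , (∣grid∣ , ∣F∩L∣≤q grid) , grid-weight (ℕ.n≤1+n _) (∣F∩L∣≤q grid)))
    where
    open NatSolver.+-*-Solver using (con; _:=_; _:+_; _:*_; _:^_) renaming (solve to ℕ-solve)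
    q+q[q-1]≡q² : q ℕ.+ q ℕ.* suc k ≡ q ℕ.^ 2
    q+q[q-1]≡q² = ℕ-solve 1 (λ k → (con 2 :+ k) :+ (con 2 :+ k) :* (con 1 :+ k) := (con 2 :+ k) :^ 2) refl k
    large : q ℕ.* q ≤ u ℕ.+ 2 ℕ.* suc k
    large = ℕ.≤-trans (ℕ.≤-reflexive (ℕ-solve 1 (λ k → (con 2 :+ k) :* (con 2 :+ k) := (con 2 :+ k) :* k :+ con 2 :+ con 2 :* (con 1 :+ k)) refl k))
      (ℕ.+-monoˡ-≤ (2 ℕ.* suc k) lower)
    open Grid {q} {suc k} {u} ℕ.≤-refl (ℕ.n≤1+n _) upper

  -- Fewer than q points are missing, so every class has a full line.
  few-missing-value : ∀ u → q ℕ.^ 2 ℕ.∸ q ℕ.+ 1 ≤ u → u ≤ q ℕ.^ 2 → ℓ⟨ u ⟩≡ q ℕ.^ 2 ℕ.+ q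
  few-missing-value u lower upper rewrite q²∸q k = subst (ℓ⟨ u ⟩≡_) [q+1]q≡q²+q (ℓ-intro {m = suc q ℕ.* q}
    (uniform-lower {m = suc k} (ℕ.<-≤-trans (ℕ.m<m+n (q ℕ.* suc k) (s≤s z≤n)) lower))
    (grid , (∣grid∣ , ∣F∩L∣≤q grid) , uniform-bound grid (∣F∩L∣≤q grid)))
    where
    q²≡q*q : q ℕ.^ 2 ≡ q ℕ.* q
    q²≡q*q = cong (q ℕ.*_) (ℕ.*-identityʳ q)
    [q+1]q≡q²+q : suc q ℕ.* q ≡ q ℕ.^ 2 ℕ.+ q
    [q+1]q≡q²+q = trans (ℕ.+-comm q (q ℕ.* q)) (cong (ℕ._+ q) (sym q²≡q*q))
    open Grid {q} {q} {u} ℕ.≤-refl ℕ.≤-refl (subst (u ≤_) q²≡q*q upper)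

open import Data.Nat.Base using (_+_; _*_; _∸_; _^_; _⊓_)

theorem4p4 : (q : ℕ) → IsPrimePower q → (K : FiniteField q) →
    let open AG K in
    (∀ n u → 1 ≤ n → 1 ≤ u → u ≤ n ⊓ q → ArcExists u n → ℓ⟨ u ∶ n ⟩≡ u + q)
    × (∀ s → 1 ≤ s → s ≤ q → ℓ⟨ s * q ⟩≡ s * q + q)
    × (∀ n → 2 ≤ n → ArcExists (q + 1) n → ℓ⟨ q + 1 ∶ n ⟩≡ 2 * (q + 1))
    × (2 ∣ q → ∀ n → 2 ≤ n → ArcExists (q + 2) n → ℓ⟨ q + 2 ∶ n ⟩≡ 2 * (q + 1))
    × (ℓ⟨ q ^ 2 ∸ 2 * q + 1 ⟩≡ q ^ 2 ∸ 1)
    × (∀ u → q ^ 2 ∸ 2 * q + 2 ≤ u → u ≤ q ^ 2 ∸ q → ℓ⟨ u ⟩≡ q ^ 2)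
    × (∀ u → q ^ 2 ∸ q + 1 ≤ u → u ≤ q ^ 2 → ℓ⟨ u ⟩≡ q ^ 2 + q)
-- A field has at least two elements, so q can be written as k + 2.
theorem4p4 0 _ K with () ← FieldProperties.1<q K
theorem4p4 1 _ K with s≤s () ← FieldProperties.1<q K
theorem4p4 (suc (suc k)) q-pp K =
    (λ n u _ 1≤u u≤n⊓q _ → collinear-value n u 1≤u u≤n⊓q)
  , parallel-lines-value
  , (λ n 2≤n _ → oval-value n 2≤n)
  , (λ 2∣q n 2≤n _ → hyperoval-value q-pp 2∣q n 2≤n)
  , two-lines-value
  , one-line-value
  , few-missing-value
  where
  open Values K
  open LargeValues K
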